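{- Let $P$ be a poset with no infinite antichain. Then the following are equivalent: (i) $P$ is bqo; (ii) $(P;\leq_{succ})$ is bqo; (iii) $(P;\leq_{pred})$ is bqo; (iv) $(P;\leq_{crit})$ is bqo; (v) $AM(P)$ is bqo.
   Context: For $a,b\in P$: $a\leq_{pred} b$ iff every $x\in P$ with $x<a$ satisfies $x<b$; $a\leq_{succ} b$ iff every $y\in P$ with $b<y$ satisfies $a<y$; $a\leq_{crit} b$ iff both $a\leq_{pred} b$ and $a\leq_{succ} b$. These are quasi-orders on $P$. $AM(P)$ is the set of maximal antichains of $P$, ordered by domination: $X\leq Y$ iff for every $x\in X$ there is $y\in Y$ with $x\leq y$. Barriers and bqo: finite subsets of $\mathbb{N}$ are identified with their increasing enumerations. For finite $s,t\subseteq\mathbb{N}$ write $s\triangleleft t$ if there is a finite $r\subseteq\mathbb{N}$ such that $s$ is a proper initial segment of $r$ and $t$ is $r$ with its least element removed. A barrier is an infinite set $B$ of finite subsets of $\mathbb{N}$, no member of which is a proper subset of another, such that every infinite $X\subseteq\bigcup B$ has a nonempty initial segment belonging to $B$. A barrier is well-ordered by the lexicographic order; its order type is the type of this well-order. A map $f$ from a barrier $B$ into a quasi-ordered set $Q$ is good if there exist $s,t\in B$ with $s\triangleleft t$ and $f(s)\leq f(t)$, and bad otherwise. For a countable ordinal $\alpha$, $Q$ is $\alpha$-bqo if every map from a barrier of order type at most $\alpha$ into $Q$ is good; $Q$ is better-quasi-ordered (bqo) if it is $\alpha$-bqo for every countable ordinal $\alpha$. -}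

module Defs where

open import Data.List.Base using (List; []; _∷_)
import Data.List.Membership.Propositional as ListMembership
import Data.List.Membership.Setoid as SetoidMembership
open import Data.List.Relation.Binary.Lex.Strict using (Lex-<)
open import Data.List.Relation.Binary.Prefix.Heterogeneous using (Prefix)
open import Data.List.Relation.Binary.Subset.Propositional using () renaming (_⊆_ to _⊆ₗ_)
open import Data.List.Relation.Unary.Linked using (Linked)
open import Data.Nat.Base using (ℕ) renaming (_<_ to _<ₙ_; _≤_ to _≤ₙ_)
open import Data.Product.Base using (Σ; ∃; ∃₂; _×_; _,_; proj₁; proj₂)
open import Data.Refinement using (Refinement-syntax; value)
open import Function.Base using (_∘_; _on_)
open import Function.Bundles using (Injection)
open import Induction.WellFounded using (WellFounded)
open import Level using (Level; 0ℓ; suc; _⊔_)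
open import Relation.Binary.Bundles using (Poset; Preorder; Setoid; StrictTotalOrder)
open import Relation.Binary.Core using (Rel)
import Relation.Binary.Properties.Poset as PosetProperties
open import Relation.Binary.PropositionalEquality.Core using (_≡_; _≢_)
open import Relation.Binary.PropositionalEquality.Properties using (setoid)
open import Relation.Nullary.Negation.Core using (¬_)
open import Relation.Unary using (Pred; _∈_; _⊆_; _≐_)
open import Relation.Unary.Properties using (≐-refl; ≐-sym; ≐-trans)

private
  variable
    c ℓ ℓ₁ ℓ₂ p : Level

module _ (S : Setoid c ℓ) where
  open Setoid S using (Carrier)
  open SetoidMembership S using () renaming (_∈_ to _∈ₛ_)

  Finite : Pred Carrier p → Set (c ⊔ ℓ ⊔ p)
  Finite X = ∃ λ (xs : List Carrier) → X ⊆ (_∈ₛ xs)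

  Infinite : Pred Carrier p → Set (c ⊔ ℓ ⊔ p)
  Infinite X = ¬ Finite X

-- A finite subset of ℕ is represented by its increasing enumeration,
-- that is, by a list s with Increasing s.

Increasing : Pred (List ℕ) 0ℓ
Increasing = Linked _<ₙ_

_⊂ₗ_ : Rel (List ℕ) 0ℓ
s ⊂ₗ t = s ⊆ₗ t × ¬ (t ⊆ₗ s)

_InitialSegmentOf_ : List ℕ → Pred ℕ 0ℓ → Set
s InitialSegmentOf X =
  (∀ {n} → n ∈ₗ s → n ∈ X) × (∀ {m n} → n ∈ₗ s → m ∈ X → m ≤ₙ n → m ∈ₗ s)
  where open ListMembership using () renaming (_∈_ to _∈ₗ_)

_ProperInitialSegmentOf_ : Rel (List ℕ) 0ℓ
s ProperInitialSegmentOf r = Prefix _≡_ s r × s ≢ r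

infix 4 _◁_

-- As r is increasing, its least element is its head.
_◁_ : Rel (List ℕ) 0ℓ
s ◁ t = ∃ λ r → Increasing r × s ProperInitialSegmentOf r × (∃ λ n → r ≡ n ∷ t)

⋃ : Pred (List ℕ) 0ℓ → Pred ℕ 0ℓ
⋃ B n = ∃ λ s → s ∈ B × n ∈ₗ s
  where open ListMembership using () renaming (_∈_ to _∈ₗ_)

record Barrier : Set₁ where
  field
    Members       : Pred (List ℕ) 0ℓ
    increasing    : ∀ {s} → s ∈ Members → Increasing s
    infinite      : Infinite (setoid (List ℕ)) Members
    incomparable  : ∀ {s t} → s ∈ Members → t ∈ Members → ¬ (s ⊂ₗ t)
    blocks        : ∀ (X : Pred ℕ 0ℓ) → Infinite (setoid ℕ) X → X ⊆ ⋃ Members →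
                    ∃ λ s → s ∈ Members × s ≢ [] × s InitialSegmentOf X

  -- The membership proof is irrelevant, so a function on Element is a function
  -- on the subset Members.
  Element : Set
  Element = [ s ∈ List ℕ ∣ s ∈ Members ]

  _<lex_ : Rel Element 0ℓ
  _<lex_ = Lex-< _≡_ _<ₙ_ on value

-- Countable ordinals are represented by countable well-ordered sets, finite ones
-- included.
record CountableOrdinal : Set₁ where
  field
    strictTotalOrder : StrictTotalOrder 0ℓ 0ℓ 0ℓ
  open StrictTotalOrder strictTotalOrder public
  field
    wellFounded : WellFounded _<_
    countable   : Injection Eq.setoid (setoid ℕ)

-- The order type of (B, <lex) is at most α: B is isomorphic to an initial segment
-- of α. As <lex is total, a strictly increasing map is an isomorphism onto its
-- image.
record OrderTypeAtMost (B : Barrier) (α : CountableOrdinal) : Set where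
  open Barrier B using (Element; _<lex_)
  open CountableOrdinal α using (Carrier; _≈_; _<_)
  field
    rank           : Element → Carrier
    rank-mono      : ∀ {s t} → s <lex t → rank s < rank t
    rank-initial   : ∀ {x s} → x < rank s → ∃ λ t → rank t ≈ x

module _ (Q : Preorder c ℓ₁ ℓ₂) where
  open Preorder Q using (Carrier; _≲_)

  Good : (B : Barrier) → (Barrier.Element B → Carrier) → Set ℓ₂
  Good B f = ∃₂ λ s t → value s ◁ value t × f s ≲ f t

  AlphaBqo : CountableOrdinal → Set (suc 0ℓ ⊔ c ⊔ ℓ₂)
  AlphaBqo α = (B : Barrier) → OrderTypeAtMost B α →
               (f : Barrier.Element B → Carrier) → Good B f

  Bqo : Set (suc 0ℓ ⊔ c ⊔ ℓ₂)
  Bqo = (α : CountableOrdinal) → AlphaBqo α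

module _ (P : Poset c ℓ₁ ℓ₂) where
  open Poset P renaming (Carrier to A)
  open PosetProperties P using (_<_; <-respˡ-≈; <-respʳ-≈)

  _≤pred_ : Rel A (c ⊔ ℓ₁ ⊔ ℓ₂)
  a ≤pred b = ∀ x → x < a → x < b

  _≤succ_ : Rel A (c ⊔ ℓ₁ ⊔ ℓ₂)
  a ≤succ b = ∀ y → b < y → a < y

  _≤crit_ : Rel A (c ⊔ ℓ₁ ⊔ ℓ₂)
  a ≤crit b = a ≤pred b × a ≤succ b

  predPreorder : Preorder c ℓ₁ (c ⊔ ℓ₁ ⊔ ℓ₂)
  predPreorder = record
    { _≲_        = _≤pred_
    ; isPreorder = record
      { isEquivalence = isEquivalence
      ; reflexive     = λ a≈b x → <-respʳ-≈ a≈b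
      ; trans         = λ a≤b b≤d x → b≤d x ∘ a≤b x
      }
    }

  succPreorder : Preorder c ℓ₁ (c ⊔ ℓ₁ ⊔ ℓ₂)
  succPreorder = record
    { _≲_        = _≤succ_
    ; isPreorder = record
      { isEquivalence = isEquivalence
      ; reflexive     = λ a≈b y → <-respˡ-≈ (Eq.sym a≈b)
      ; trans         = λ a≤b b≤d y → a≤b y ∘ b≤d y
      }
    }

  critPreorder : Preorder c ℓ₁ (c ⊔ ℓ₁ ⊔ ℓ₂)
  critPreorder = record
    { _≲_        = _≤crit_
    ; isPreorder = record
      { isEquivalence = isEquivalence
      ; reflexive     = λ a≈b → Preorder.reflexive predPreorder a≈b
                              , Preorder.reflexive succPreorder a≈b
      ; trans         = λ (p₁ , s₁) (p₂ , s₂) → Preorder.trans predPreorder p₁ p₂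
                                              , Preorder.trans succPreorder s₁ s₂
      }
    }

  Subset : Set (suc (c ⊔ ℓ₁ ⊔ ℓ₂))
  Subset = Pred A (c ⊔ ℓ₁ ⊔ ℓ₂)

  IsAntichain : Subset → Set (c ⊔ ℓ₁ ⊔ ℓ₂)
  IsAntichain X = ∀ {x y} → x ∈ X → y ∈ X → x ≤ y → x ≈ y

  NoInfiniteAntichain : Set (suc (c ⊔ ℓ₁ ⊔ ℓ₂))
  NoInfiniteAntichain = ¬ (∃ λ (X : Subset) → IsAntichain X × Infinite Eq.setoid X)

  -- Maximality forces X to be closed under ≈.
  IsMaximalAntichain : Subset → Set (suc (c ⊔ ℓ₁ ⊔ ℓ₂))
  IsMaximalAntichain X = IsAntichain X × (∀ Y → IsAntichain Y → X ⊆ Y → Y ⊆ X)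

  _≤dom_ : Rel Subset (c ⊔ ℓ₁ ⊔ ℓ₂)
  X ≤dom Y = ∀ {x} → x ∈ X → ∃ λ y → y ∈ Y × x ≤ y

  private
    closed : ∀ {X x y} → IsMaximalAntichain X → x ∈ X → x ≈ y → y ∈ X
    closed {X} {x} (anti , max) x∈X x≈y = max X≈ anti≈ (λ z∈X → _ , z∈X , Eq.refl) (x , x∈X , x≈y)
      where
      X≈ : Subset
      X≈ z = ∃ λ w → w ∈ X × w ≈ z

      anti≈ : IsAntichain X≈
      anti≈ (v , v∈X , v≈x) (w , w∈X , w≈y) x≤y =
        Eq.trans (Eq.sym v≈x) (Eq.trans
          (anti v∈X w∈X (trans (reflexive v≈x) (trans x≤y (reflexive (Eq.sym w≈y)))))
          w≈y)

    ≤dom-antisym-⊆ : ∀ {X Y} → IsMaximalAntichain X → IsMaximalAntichain Y →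
                     X ≤dom Y → Y ≤dom X → X ⊆ Y
    ≤dom-antisym-⊆ X-max Y-max X≤Y Y≤X x∈X with X≤Y x∈X
    ... | y , y∈Y , x≤y with Y≤X y∈Y
    ...   | z , z∈X , y≤z =
      closed Y-max y∈Y
        (antisym (trans y≤z (reflexive (Eq.sym (proj₁ X-max x∈X z∈X (trans x≤y y≤z))))) x≤y)

  AM : Poset (suc (c ⊔ ℓ₁ ⊔ ℓ₂)) (c ⊔ ℓ₁ ⊔ ℓ₂) (c ⊔ ℓ₁ ⊔ ℓ₂)
  AM = record
    { Carrier        = Σ Subset IsMaximalAntichain
    ; _≈_            = λ X Y → proj₁ X ≐ proj₁ Y
    ; _≤_            = λ X Y → proj₁ X ≤dom proj₁ Y
    ; isPartialOrder = record
      { isPreorder = record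
        { isEquivalence = record { refl = ≐-refl ; sym = ≐-sym ; trans = ≐-trans }
        ; reflexive     = λ X≐Y x∈X → _ , proj₁ X≐Y x∈X , refl
        ; trans         = λ X≤Y Y≤Z x∈X →
            let (y , y∈Y , x≤y) = X≤Y x∈X
                (z , z∈Z , y≤z) = Y≤Z y∈Y
            in z , z∈Z , trans x≤y y≤z
        }
      ; antisym    = λ {X} {Y} X≤Y Y≤X →
          ≤dom-antisym-⊆ (proj₂ X) (proj₂ Y) X≤Y Y≤X ,
          ≤dom-antisym-⊆ (proj₂ Y) (proj₂ X) Y≤X X≤Y
      }
    }

{-# OPTIONS --safe #-}
module Submission where

-- A map on a barrier B gives a locally constant map F on the infinite subsets X of
-- ⋃ B, taking at X the value of the initial segment of X in B; it is good iff
-- F(X) ≤ F(X⁻) for some X, where X⁻ is X without its least element. Conversely the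
-- Nash-Williams partition theorem turns every locally constant map into a map on a
-- barrier. In this form the implications read as follows.
--
-- * P ⇒ AM(P): if F is bad, choose h(X) ∈ F(X) below no element of F(X⁻); h is bad.
-- * pred ⇒ succ: if F is bad for ≤succ, choose h(X) > F(X⁻) with h(X) ≯ F(X); then
--   F(X⁻) < h(X) and F(X⁻) ≮ h(X⁻), so h is bad for ≤pred.
-- * AM(P) ⇒ pred: P is well founded, and the minimal elements of {z ∣ z ≮ x} form a
--   maximal antichain A(x) such that A(x) ≤ A(y) implies x ≤pred y.
-- * succ ⇒ P: if F is bad for ≤, then after passing to an infinite subset
--   F(X) ≤succ F(X⁻) and F(X) ≰ F(X⁻) for all X, and F(X) < F(Z) for all far tails
--   Z of X. Fix an initial segment s of X determining F(X), of length n, and put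
--   Y_j = s ∪ Z_j with F(Z_j) strictly increasing in j. Removing least elements one
--   by one leads from Y_j to Z_j in n steps; going back, at each step some
--   subsequence of the values is still strictly increasing. But F(Y_j) is constant.

open import Defs
open import Axiom.ExcludedMiddle using (ExcludedMiddle)
open import Data.Bool.Base using (Bool; true; false)
open import Data.Empty using (⊥; ⊥-elim)
open import Data.Fin.Base using (Fin; toℕ)
open import Data.Fin.Properties using (pigeonhole)
import Data.Irrelevant as Irrelevant
open import Data.List.Base using (List; []; _∷_; _∷ʳ_; _++_; applyUpTo; length; lookup; map; upTo)
open import Data.List.Membership.Propositional using (_∈_)
open import Data.List.Membership.Propositional.Properties
  using (∈-applyUpTo⁺; ∈-applyUpTo⁻; ∈-map⁺; ∈-map⁻; ∈-upTo⁺; ∈-++⁺ˡ; ∈-++⁺ʳ)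
import Data.List.Properties as List
import Data.List.Relation.Binary.Lex.Strict as Lex
open import Data.List.Relation.Binary.Pointwise using (Pointwise-≡⇒≡; ≡⇒Pointwise-≡)
open import Data.List.Relation.Binary.Prefix.Heterogeneous using (Prefix; []; _∷_)
open import Data.List.Relation.Binary.Sublist.Heterogeneous.Properties using (toPointwise; length-mono-≤)
open import Data.List.Relation.Binary.Sublist.Propositional using ([]; _∷_; ⊆-antisym)
  renaming (_⊆_ to Sublist; _∷ʳ_ to _∷ˢ_)
open import Data.List.Relation.Binary.Subset.Propositional using () renaming (_⊆_ to _⊆ₗ_)
open import Data.List.Relation.Unary.All using () renaming (lookup to All-lookup)
open import Data.List.Relation.Unary.Any using (here; there; index)
open import Data.List.Relation.Unary.Any.Properties using (lookup-index)
import Data.List.Relation.Unary.Linked as Linked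
open import Data.List.Relation.Unary.Linked.Properties using (applyUpTo⁺₂; Linked⇒All)
open import Data.Nat.Base
  using (ℕ; zero; suc; _+_; _*_; _^_; _∸_; _⊔_; _≤_; _<_; z≤n; s≤s; z<s; s<s)
open import Data.Nat.GeneralisedArithmetic using (fold)
open import Data.Nat.Induction using (<-wellFounded)
open import Data.Nat.ListAction using (sum)
open import Data.Nat.Properties
open import Data.Product.Base using (∃; ∃₂; _×_; _,_; proj₁; proj₂)
import Data.Refinement as Refinement
open import Data.Refinement using (value; value-injective)
open import Data.Sum.Base using (_⊎_; inj₁; inj₂)
open import Function.Base using (_∘_; id)
open import Function.Bundles using (_⇔_; mk⇔)
open import Induction.WellFounded using (Acc; acc; WellFounded)
open import Level as Level using (Level; 0ℓ; Lift; lift)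
open import Relation.Binary.Bundles using (Poset; Preorder)
import Relation.Binary.Construct.On as On
open import Relation.Binary.Definitions using (tri<; tri≈; tri>)
import Relation.Binary.Properties.Poset as PosetProperties
open import Relation.Binary.PropositionalEquality
  using (_≡_; _≢_; refl; sym; trans; cong; cong₂; subst; subst₂; setoid)
open import Relation.Nullary.Decidable.Core using (Dec; yes; no; does; recompute)
open import Relation.Nullary.Negation.Core using (¬_; contradiction)
open import Relation.Unary using (Pred)

private
  variable
    a b c ℓ ℓ₁ ℓ₂ : Level
    A : Set a
    B : Set b
    C : Set c

-- Infinite subsets of ℕ are handled through their increasing enumerations. The
-- irrelevance of the proof makes enumerations equal as soon as their underlying
-- functions are.
record Inc : Set where
  constructor enum
  field
    at    : ℕ → ℕ
    .step : ∀ i → at i < at (suc i)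

open Inc using (at)

-- Decidability of `_<_` recovers a relevant proof from the irrelevant field.
at-step : ∀ X i → at X i < at X (suc i)
at-step (enum f f<) i = recompute (f i <? f (suc i)) (f< i)

at-mono-< : ∀ X {i j} → i < j → at X i < at X j
at-mono-< X {i} {suc j} (s≤s i≤j) with m≤n⇒m<n∨m≡n i≤j
... | inj₁ i<j  = <-trans (at-mono-< X i<j) (at-step X j)
... | inj₂ refl = at-step X i

at-mono-≤ : ∀ X {i j} → i ≤ j → at X i ≤ at X j
at-mono-≤ X i≤j with m≤n⇒m<n∨m≡n i≤j
... | inj₁ i<j  = <⇒≤ (at-mono-< X i<j)
... | inj₂ refl = ≤-refl

at-cancel-< : ∀ X {i j} → at X i < at X j → i < j
at-cancel-< X Xi<Xj = ≰⇒> λ j≤i → <⇒≱ Xi<Xj (at-mono-≤ X j≤i)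

at-inflationary : ∀ X i → i ≤ at X i
at-inflationary X zero    = z≤n
at-inflationary X (suc i) = ≤-<-trans (at-inflationary X i) (at-step X i)

ident : Inc
ident = enum id n<1+n

infixr 9 _⊙_
_⊙_ : Inc → Inc → Inc
h ⊙ X = enum (at h ∘ at X) (λ i → at-mono-< h (at-step X i))

tail : Inc → Inc
tail X = enum (at X ∘ suc) (at-step X ∘ suc)

cons : ∀ n (X : Inc) → .(n < at X 0) → Inc
cons n X n<X = enum (λ { zero → n ; (suc i) → at X i }) λ { zero → n<X ; (suc i) → at-step X i }

drop : ℕ → Inc → Inc
drop zero    X = X
drop (suc n) X = drop n (tail X)

drop-tail : ∀ n X → tail (drop n X) ≡ drop n (tail X)
drop-tail zero    X = refl
drop-tail (suc n) X = drop-tail n (tail X)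

drop-⊙ : ∀ n h X → drop n (h ⊙ X) ≡ h ⊙ drop n X
drop-⊙ zero    h X = refl
drop-⊙ (suc n) h X = drop-⊙ n h (tail X)

at-drop : ∀ n X i → at (drop n X) i ≡ at X (n + i)
at-drop zero    X i = refl
at-drop (suc n) X i = at-drop n (tail X) i

-- X ⊙ skip n d is X without its entries n, …, n + d - 1.
skip : ℕ → ℕ → Inc
skip zero    d = drop d ident
skip (suc n) d = enum (λ { zero → 0 ; (suc i) → suc (at (skip n d) i) })
                       λ { zero → z<s ; (suc i) → s<s (at-step (skip n d) i) }

drop-skip : ∀ n d X → drop n (X ⊙ skip n d) ≡ drop (n + d) X
drop-skip zero    d X = sym (drop-⊙ d X ident)
drop-skip (suc n) d X = drop-skip n d (tail X)

at-skip : ∀ n d {i} → i < n → at (skip n d) i ≡ i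
at-skip (suc n) d z<s               = refl
at-skip (suc n) d (s<s i<n@(s≤s _)) = cong suc (at-skip n d i<n)

iterate : (f : ℕ → ℕ) → (∀ n → n < f n) → ℕ → Inc
iterate f n<fn n = enum go (λ i → n<fn (go i))
  where
  go : ℕ → ℕ
  go zero    = n
  go (suc i) = f (go i)

-- Locally constant maps on the infinite subsets of ℕ.

infix 4 _≈[_]_
_≈[_]_ : Inc → ℕ → Inc → Set
X ≈[ n ] Y = ∀ {i} → i < n → at X i ≡ at Y i

LocallyConstant : (Inc → A) → Set _
LocallyConstant F = ∀ X → ∃ λ n → ∀ Y → X ≈[ n ] Y → F X ≡ F Y

lc-map₂ : ∀ (φ : A → B → C) {F G} → LocallyConstant F → LocallyConstant G →
          LocallyConstant (λ X → φ (F X) (G X))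
lc-map₂ φ lcF lcG X =
  let m , F-const = lcF X
      n , G-const = lcG X
  in m ⊔ n , λ Y X≈Y → cong₂ φ
       (F-const Y λ i<m → X≈Y (<-≤-trans i<m (m≤m⊔n m n)))
       (G-const Y λ i<n → X≈Y (<-≤-trans i<n (m≤n⊔m m n)))

lc-tail : {F : Inc → A} → LocallyConstant F → LocallyConstant (F ∘ tail)
lc-tail lcF X =
  let n , F-const = lcF (tail X)
  in suc n , λ Y X≈Y → F-const (tail Y) (X≈Y ∘ s<s)

lc-⊙ : ∀ h {F : Inc → A} → LocallyConstant F → LocallyConstant (F ∘ (h ⊙_))
lc-⊙ h lcF X =
  let n , F-const = lcF (h ⊙ X)
  in n , λ Y X≈Y → F-const (h ⊙ Y) (cong (at h) ∘ X≈Y)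

-- The number of dropped entries depends on `X` too, so `Y` must agree with `X` far enough to fix
-- `l X`, and then on `n` entries beyond the first `l X`.
lc-drop : ∀ {F : Inc → A} {l} → LocallyConstant F → LocallyConstant l →
          LocallyConstant (λ X → F (drop (l X) X))
lc-drop {F = F} {l} lcF lcl X =
  let m , l-const = lcl X
      n , F-const = lcF (drop (l X) X)
  in m ⊔ (l X + n) , λ Y X≈Y →
       let lX≡lY = l-const Y λ i<m → X≈Y (<-≤-trans i<m (m≤m⊔n m _))
       in trans
            (F-const (drop (l X) Y) λ {i} i<n →
              trans (at-drop (l X) X i)
                (trans (X≈Y (<-≤-trans (+-monoʳ-< (l X) i<n) (m≤n⊔m m _)))
                       (sym (at-drop (l X) Y i))))
            (cong (λ k → F (drop k Y)) lX≡lY)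

lc-at : (f : ℕ → A) (k : ℕ) → LocallyConstant (λ X → f (at X k))
lc-at f k X = suc k , λ Y X≈Y → cong f (X≈Y (n<1+n k))

-- Initial segments and increasing lists.

applyUpTo-cong : ∀ {f g : ℕ → A} n → (∀ {i} → i < n → f i ≡ g i) → applyUpTo f n ≡ applyUpTo g n
applyUpTo-cong zero    f≗g = refl
applyUpTo-cong (suc n) f≗g = cong₂ _∷_ (f≗g z<s) (applyUpTo-cong n (f≗g ∘ s<s))

applyUpTo-injective : ∀ {f g : ℕ → A} n → applyUpTo f n ≡ applyUpTo g n → ∀ {i} → i < n → f i ≡ g i
applyUpTo-injective (suc n) eq z<s               = List.∷-injectiveˡ eq
applyUpTo-injective {f = f} {g} (suc n) eq (s<s i<n@(s≤s _)) =
  applyUpTo-injective {f = f ∘ suc} {g ∘ suc} n (List.∷-injectiveʳ eq) i<n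

take : ℕ → Inc → List ℕ
take n X = applyUpTo (at X) n

length-take : ∀ n X → length (take n X) ≡ n
length-take n X = List.length-applyUpTo (at X) n

take-increasing : ∀ n X → Increasing (take n X)
take-increasing n X = applyUpTo⁺₂ (at X) n (at-step X)

∷ʳ-increasing⁻ : ∀ p {m n} → Increasing (p ∷ʳ m ∷ʳ n) → m < n
∷ʳ-increasing⁻ []          (m<n Linked.∷ _) = m<n
∷ʳ-increasing⁻ (x ∷ [])    (_ Linked.∷ l)   = ∷ʳ-increasing⁻ [] l
∷ʳ-increasing⁻ (x ∷ y ∷ p) (_ Linked.∷ l)   = ∷ʳ-increasing⁻ (y ∷ p) l

≈[]-trans : ∀ {n X Y Z} → X ≈[ n ] Y → Y ≈[ n ] Z → X ≈[ n ] Z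
≈[]-trans X≈Y Y≈Z i<n = trans (X≈Y i<n) (Y≈Z i<n)

take-cong : ∀ {m n X Y} → m ≡ n → X ≈[ m ] Y → take m X ≡ take n Y
take-cong {m} refl X≈Y = applyUpTo-cong m X≈Y

prefix-of-take : ∀ p {q n X} → p ++ q ≡ take n X → p ≡ take (length p) X
prefix-of-take []              eq = refl
prefix-of-take (x ∷ p) {n = suc n} {X} eq =
  cong₂ _∷_ (List.∷-injectiveˡ eq) (prefix-of-take p {n = n} {tail X} (List.∷-injectiveʳ eq))

-- Beyond the first `n` values the enumeration continues by successors.
complete : ∀ n (f : ℕ → ℕ) → (∀ {i} → suc i < n → f i < f (suc i)) →
           ∃ λ X → ∀ {i} → i < n → at X i ≡ f i
complete n f f< = enum g step , agrees
  where
  g : ℕ → ℕ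
  g zero = f 0
  g (suc i) with suc i <? n
  ... | yes _ = f (suc i)
  ... | no _  = suc (g i)

  agrees : ∀ {i} → i < n → g i ≡ f i
  agrees {zero}  _ = refl
  agrees {suc i} 1+i<n with suc i <? n
  ... | yes _ = refl
  ... | no ¬1+i<n = contradiction 1+i<n ¬1+i<n

  step : ∀ i → g i < g (suc i)
  step i with suc i <? n
  ... | yes 1+i<n = subst (_< f (suc i)) (sym (agrees (<-trans (n<1+n i) 1+i<n))) (f< 1+i<n)
  ... | no _      = n<1+n (g i)

increasing-head : ∀ {x y s} → Increasing (x ∷ s) → y ∈ s → x < y
increasing-head (x<z Linked.∷ inc) y∈s = All-lookup (Linked⇒All <-trans x<z inc) y∈s

increasing-tail : ∀ {x s} → Increasing (x ∷ s) → Increasing s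
increasing-tail Linked.[-]       = Linked.[]
increasing-tail (_ Linked.∷ inc) = inc

<⇒∈-tail : ∀ {y z t} → y < z → z ∈ y ∷ t → z ∈ t
<⇒∈-tail y<z (here refl) = contradiction y<z (<-irrefl refl)
<⇒∈-tail y<z (there z∈t) = z∈t

⊆⇒Sublist : ∀ {s t} → Increasing s → Increasing t → s ⊆ₗ t → Sublist s t
⊆⇒Sublist {[]}    {[]}    _ _ _ = []
⊆⇒Sublist {x ∷ s} {[]}    _ _ s⊆t with () ← s⊆t (here refl)
⊆⇒Sublist {[]}    {y ∷ t} inc-s inc-t s⊆t = y ∷ˢ ⊆⇒Sublist inc-s (increasing-tail inc-t) λ ()
⊆⇒Sublist {x ∷ s} {y ∷ t} inc-s inc-t s⊆t with s⊆t (here refl)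
... | here refl = refl ∷ ⊆⇒Sublist (increasing-tail inc-s) (increasing-tail inc-t) λ z∈s →
                    <⇒∈-tail (increasing-head inc-s z∈s) (s⊆t (there z∈s))
... | there x∈t = y ∷ˢ ⊆⇒Sublist inc-s (increasing-tail inc-t) λ where
    (here refl) → x∈t
    (there z∈s) → <⇒∈-tail (<-trans (increasing-head inc-t x∈t) (increasing-head inc-s z∈s))
                           (s⊆t (there z∈s))

⊂⇒length< : ∀ {s t} → Increasing s → Increasing t → s ⊂ₗ t → length s < length t
⊂⇒length< {s} {t} inc-s inc-t (s⊆t , t⊈s) = ≤∧≢⇒< (length-mono-≤ sub) λ eq →
  t⊈s λ z∈t → subst (_ ∈_) (sym (Pointwise-≡⇒≡ (toPointwise eq sub))) z∈t
  where
  sub : Sublist s t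
  sub = ⊆⇒Sublist inc-s inc-t s⊆t

-- Countability and the lexicographic order of finite sequences.

-- The pairing `2 ^ x * (2 * k + 1)` takes only positive values, which leaves 0 for `[]`.
code : List ℕ → ℕ
code []      = 0
code (x ∷ s) = 2 ^ x * suc (2 * code s)

power-times-odd-injective : ∀ x y {m n} → 2 ^ x * suc (2 * m) ≡ 2 ^ y * suc (2 * n) → x ≡ y × m ≡ n
power-times-odd-injective zero zero eq =
  refl , *-cancelˡ-≡ _ _ 2 (suc-injective (trans (sym (*-identityˡ _)) (trans eq (*-identityˡ _))))
power-times-odd-injective zero (suc y) {m} {n} eq =
  contradiction (trans (sym (*-assoc 2 (2 ^ y) _)) (trans (sym eq) (*-identityˡ _))) (even≢odd (2 ^ y * suc (2 * n)) m)
power-times-odd-injective (suc x) zero {m} {n} eq =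
  contradiction (trans (sym (*-assoc 2 (2 ^ x) _)) (trans eq (*-identityˡ _))) (even≢odd (2 ^ x * suc (2 * m)) n)
power-times-odd-injective (suc x) (suc y) eq =
  let x≡y , m≡n = power-times-odd-injective x y
        (*-cancelˡ-≡ _ _ 2 (trans (sym (*-assoc 2 (2 ^ x) _)) (trans eq (*-assoc 2 (2 ^ y) _))))
  in cong suc x≡y , m≡n

power-times-odd≢0 : ∀ x {n} → 2 ^ x * suc n ≢ 0
power-times-odd≢0 x eq with m*n≡0⇒m≡0∨n≡0 (2 ^ x) eq
... | inj₁ 2^x≡0 with () ← m^n≡0⇒m≡0 2 x 2^x≡0
... | inj₂ ()

code-injective : ∀ {s t} → code s ≡ code t → s ≡ t
code-injective {[]}    {[]}    eq = refl
code-injective {[]}    {y ∷ t} eq = contradiction (sym eq) (power-times-odd≢0 y)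
code-injective {x ∷ s} {[]}    eq = contradiction eq (power-times-odd≢0 x)
code-injective {x ∷ s} {y ∷ t} eq =
  let x≡y , s≡t = power-times-odd-injective x y eq in cong₂ _∷_ x≡y (code-injective s≡t)

_<ₗ_ : List ℕ → List ℕ → Set
_<ₗ_ = Lex.Lex-< _≡_ _<_

-- Reduces accessibility below `p ∷ʳ n` to sequences below `p`, to `p` itself, and to extensions of
-- `p` by a smaller entry, so that induction on `n` applies.
<ₗ-∷ʳ : ∀ p {n t} → t <ₗ (p ∷ʳ n) → t <ₗ p ⊎ t ≡ p ⊎ (∃₂ λ m q → m < n × t ≡ p ++ m ∷ q)
<ₗ-∷ʳ []      Lex.halt           = inj₂ (inj₁ refl)
<ₗ-∷ʳ []      (Lex.this m<n)     = inj₂ (inj₂ (_ , _ , m<n , refl))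
<ₗ-∷ʳ []      (Lex.next _ (Lex.base ()))
<ₗ-∷ʳ (x ∷ p) Lex.halt           = inj₁ Lex.halt
<ₗ-∷ʳ (x ∷ p) (Lex.this y<x)     = inj₁ (Lex.this y<x)
<ₗ-∷ʳ (x ∷ p) (Lex.next refl t<) with <ₗ-∷ʳ p t<
... | inj₁ t<p                         = inj₁ (Lex.next refl t<p)
... | inj₂ (inj₁ refl)                 = inj₂ (inj₁ refl)
... | inj₂ (inj₂ (m , q , m<n , refl)) = inj₂ (inj₂ (m , q , m<n , refl))

∈⇒≤sum : ∀ {n s} → n ∈ s → n ≤ sum s
∈⇒≤sum {s = x ∷ s} (here refl) = m≤m+n x (sum s)
∈⇒≤sum {s = x ∷ s} (there n∈s) = ≤-trans (∈⇒≤sum n∈s) (m≤n+m (sum s) x)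

-- Fronts and their restrictions.

-- The segments pre X form a front: a barrier up to the antichain condition, which
-- Thin adds.
record Front {A : Set a} (F : Inc → A) : Set a where
  field
    len        : Inc → ℕ
    len-pos    : ∀ X → 0 < len X
    determined : ∀ {X Y} → X ≈[ len X ] Y → len X ≡ len Y × F X ≡ F Y

  pre : Inc → List ℕ
  pre X = take (len X) X

  length-pre : ∀ X → length (pre X) ≡ len X
  length-pre X = length-take (len X) X

  pre-cong : ∀ {X Y} → X ≈[ len X ] Y → pre X ≡ pre Y
  pre-cong {X} {Y} X≈Y = take-cong {len X} {len Y} {X} {Y} (proj₁ (determined X≈Y)) X≈Y

  pre≡take⇒≈ : ∀ {X Y} → pre X ≡ take (length (pre X)) Y → X ≈[ len X ] Y
  pre≡take⇒≈ {X} {Y} eq = applyUpTo-injective (len X) (subst (λ n → pre X ≡ take n Y) (length-pre X) eq)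

  lc-len : LocallyConstant len
  lc-len X = len X , λ Y X≈Y → proj₁ (determined X≈Y)

  lc-pre : LocallyConstant pre
  lc-pre X = len X , λ Y → pre-cong

restrict : ∀ h {F : Inc → A} → Front F → Front (F ∘ (h ⊙_))
restrict h fr = record
  { len        = λ X → len (h ⊙ X)
  ; len-pos    = λ X → len-pos (h ⊙ X)
  ; determined = λ X≈Y → determined (cong (at h) ∘ X≈Y)
  }
  where open Front fr

Thin : ∀ {F : Inc → A} → Front F → Set
Thin fr = ∀ X Y → ¬ (pre X ⊂ₗ pre Y)
  where open Front fr

-- Bqo in terms of locally constant maps on infinite sets.
BqoSeq : Preorder c ℓ₁ ℓ₂ → Set _
BqoSeq Q = ∀ F → LocallyConstant F → ∃ λ X → F X ≲ F (tail X)
  where open Preorder Q using (_≲_)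

Prefix⇒++ : ∀ {s r : List ℕ} → Prefix _≡_ s r → ∃ λ q → s ++ q ≡ r
Prefix⇒++ {r = r} []  = r , refl
Prefix⇒++ (refl ∷ pf) = let q , eq = Prefix⇒++ pf in q , cong (_ ∷_) eq

take-Prefix : ∀ {m n} (f : ℕ → ℕ) → m ≤ n → Prefix _≡_ (applyUpTo f m) (applyUpTo f n)
take-Prefix f z≤n       = []
take-Prefix f (s≤s m≤n) = refl ∷ take-Prefix (f ∘ suc) m≤n

Prefix⇒⊆ : ∀ {s r : List ℕ} → Prefix _≡_ s r → s ⊆ₗ r
Prefix⇒⊆ (refl ∷ pf) (here eq)  = here eq
Prefix⇒⊆ (refl ∷ pf) (there z∈) = there (Prefix⇒⊆ pf z∈)

sublists : List ℕ → List (List ℕ)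
sublists []      = [] ∷ []
sublists (x ∷ s) = sublists s ++ map (x ∷_) (sublists s)

Sublist⇒∈sublists : ∀ {s t} → Sublist s t → s ∈ sublists t
Sublist⇒∈sublists []            = here refl
Sublist⇒∈sublists (y ∷ˢ sub)    = ∈-++⁺ˡ (Sublist⇒∈sublists sub)
Sublist⇒∈sublists (_∷_ {ys = t} refl sub) = ∈-++⁺ʳ (sublists t) (∈-map⁺ (_ ∷_) (Sublist⇒∈sublists sub))

range : Inc → Pred ℕ 0ℓ
range X n = ∃ λ i → n ≡ at X i

range-infinite : ∀ X → Infinite (setoid ℕ) (range X)
range-infinite X (ns , X⊆ns) =
  <⇒≱ (at-inflationary X (suc (sum ns))) (∈⇒≤sum (X⊆ns (suc (sum ns) , refl)))

-- Downward closure puts `at X 0` into `s`, hence at its head; what remains is an initial segment of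
-- `tail X`.
initialSegment⇒take : ∀ {s} X → Increasing s → s InitialSegmentOf range X → s ≡ take (length s) X
initialSegment⇒take {[]}    X _ _ = refl
initialSegment⇒take {x ∷ s} X inc (s⊆X , down) =
  cong₂ _∷_ x≡X0 (initialSegment⇒take (tail X) (increasing-tail inc) (tail-range , tail-down))
  where
  X0≤x : at X 0 ≤ x
  X0≤x = let i , x≡Xi = s⊆X (here refl) in subst (at X 0 ≤_) (sym x≡Xi) (at-mono-≤ X z≤n)

  x≡X0 : x ≡ at X 0
  x≡X0 with down (here refl) (0 , refl) X0≤x
  ... | here X0≡x = sym X0≡x
  ... | there X0∈s = contradiction X0≤x (<⇒≱ (increasing-head inc X0∈s))

  tail-range : ∀ {n} → n ∈ s → range (tail X) n
  tail-range n∈s with s⊆X (there n∈s)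
  ... | zero  , n≡X0 = contradiction (increasing-head inc n∈s) (<-irrefl (trans x≡X0 (sym n≡X0)))
  ... | suc i , n≡Xi = i , n≡Xi

  tail-down : ∀ {m n} → n ∈ s → range (tail X) m → m ≤ n → m ∈ s
  tail-down n∈s (j , m≡Xj) m≤n with down (there n∈s) (suc j , m≡Xj) m≤n
  ... | there m∈s = m∈s
  ... | here m≡x  =
    contradiction (at-mono-< X z<s) (<-irrefl (trans (sym x≡X0) (trans (sym m≡x) m≡Xj)))

drop-+ : ∀ m n X → drop (m + n) X ≡ drop n (drop m X)
drop-+ zero    n X = refl
drop-+ (suc m) n X = drop-+ m n (tail X)

drop-∸ : ∀ {m n} X → m ≤ n → drop n X ≡ drop (n ∸ m) (drop m X)
drop-∸ {m} X m≤n = trans (cong (λ k → drop k X) (sym (m+[n∸m]≡n m≤n))) (drop-+ m _ X)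

-- Makes `i < j` the first two entries of an infinite set, so that homogeneity for a colouring of
-- two entries yields Ramsey's theorem for pairs.
fromTwo : ∀ i j → i < j → Inc
fromTwo i j i<j = enum (λ { zero → i ; (suc k) → k + j }) λ { zero → i<j ; (suc k) → n<1+n (k + j) }

-- The hypothesis is applied to X without its entries number len X, …, m - 1,
-- whose removal changes neither len X nor F X.
spread : ∀ {F : Inc → A} (fr : Front F) (R : A → A → Set ℓ) → let open Front fr in
         (∀ X → R (F X) (F (drop (len X) X))) →
         ∀ X {m} → len X ≤ m → R (F X) (F (drop m X))
spread {F = F} fr R hom X {m} l≤m =
  subst₂ R (sym (proj₂ same)) (cong F (trans (cong (λ k → drop k Y) (sym (proj₁ same))) dropped)) (hom Y)
  where
  open Front fr
  Y : Inc
  Y = X ⊙ skip (len X) (m ∸ len X)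

  same : len X ≡ len Y × F X ≡ F Y
  same = determined (λ i<l → cong (at X) (sym (at-skip (len X) (m ∸ len X) i<l)))

  dropped : drop (len X) Y ≡ drop m X
  dropped = trans (drop-skip (len X) (m ∸ len X) X) (cong (λ k → drop k X) (m+[n∸m]≡n l≤m))

module Classical (em : ∀ ℓ → ExcludedMiddle ℓ) where

  -- Classical principles and bar induction.

  dec : (P : Set ℓ) → Dec P
  dec {ℓ} P = em ℓ

  by-contradiction : {P : Set ℓ} → ¬ ¬ P → P
  by-contradiction {P = P} ¬¬p with dec P
  ... | yes p = p
  ... | no ¬p = ⊥-elim (¬¬p ¬p)

  ¬∀⇒∃¬ : {P : A → Set ℓ} → ¬ (∀ x → P x) → ∃ λ x → ¬ P x
  ¬∀⇒∃¬ ¬∀ = by-contradiction λ ¬∃ → ¬∀ λ x → by-contradiction λ ¬p → ¬∃ (x , ¬p)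

  least : (P : ℕ → Set ℓ) → ∃ P → ∃ λ n → P n × (∀ {m} → m < n → ¬ P m)
  least P (n , p) = go n p (<-wellFounded n)
    where
    go : ∀ n → P n → Acc _<_ n → ∃ λ n → P n × (∀ {m} → m < n → ¬ P m)
    go n p (acc rec) with dec (∃ λ m → m < n × P m)
    ... | yes (m , m<n , q) = go m q (rec m<n)
    ... | no ¬∃             = n , p , λ m<n q → ¬∃ (_ , m<n , q)

  frequently-or-finally-not : (P : ℕ → Set ℓ) →
    (∃ λ (g : Inc) → ∀ i → P (at g i)) ⊎ (∃ λ N → ∀ {m} → N ≤ m → ¬ P m)
  frequently-or-finally-not P with dec (∀ N → ∃ λ m → N ≤ m × P m)
  ... | yes next = inj₁ (g , Pg)
    where
    g : Inc
    g = iterate (λ n → proj₁ (next (suc n))) (λ n → proj₁ (proj₂ (next (suc n)))) (proj₁ (next 0))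
    Pg : ∀ i → P (at g i)
    Pg zero    = proj₂ (proj₂ (next 0))
    Pg (suc i) = proj₂ (proj₂ (next (suc (at g i))))
  ... | no ¬next =
    let N , ¬P = ¬∀⇒∃¬ ¬next in inj₂ (N , λ N≤m p → ¬P (_ , N≤m , p))

  -- Each new index is chosen beyond the threshold of the previous one; all later indices are then
  -- beyond it as well.
  thin-out : (R : ℕ → ℕ → Set ℓ) → (∀ i → ∃ λ N → ∀ {m} → N ≤ m → R i m) →
             ∃ λ (g : Inc) → ∀ {i j} → i < j → R (at g i) (at g j)
  thin-out R finally = g , λ {i} {j} i<j →
      proj₂ (finally (at g i))
        (≤-trans (m≤m⊔n _ _) (at-mono-≤ g i<j))
    where
    g : Inc
    g = iterate (λ n → proj₁ (finally n) ⊔ suc n) (λ n → m≤n⊔m (proj₁ (finally n)) (suc n)) 0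

  -- If `Q []` failed, failing sequences could be extended forever by one entry; the resulting path
  -- would be an infinite set that never meets the bar.
  bar-induction : (Q : List ℕ → Set ℓ) →
    (∀ X → ∃ λ n → Q (take n X)) →
    (∀ {p} → ¬ Increasing p → Q p) →
    (∀ p → (∀ n → Q (p ∷ʳ n)) → Q p) →
    Q []
  bar-induction Q bar junk ind with dec (Q [])
  ... | yes q = q
  ... | no ¬q = ⊥-elim (¬bar (bar path))
    where
    node : ℕ → ∃ λ p → ¬ Q p
    extend : ∀ k → ∃ λ n → ¬ Q (proj₁ (node k) ∷ʳ n)

    node zero    = [] , ¬q
    node (suc k) = proj₁ (node k) ∷ʳ proj₁ (extend k) , proj₂ (extend k)

    extend k = ¬∀⇒∃¬ λ q → proj₂ (node k) (ind _ q)

    path : Inc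
    -- Entries `k` and `k + 1` end the failing sequence `node (k + 2)`, which is increasing because
    -- `Q` holds at all others.
    path = enum (proj₁ ∘ extend) λ k →
      ∷ʳ-increasing⁻ (proj₁ (node k))
        (by-contradiction λ ¬inc → proj₂ (node (suc (suc k))) (junk ¬inc))

    take≡node : ∀ k → take k path ≡ proj₁ (node k)
    take≡node zero    = refl
    take≡node (suc k) = trans (sym (List.applyUpTo-∷ʳ (at path) k)) (cong (_∷ʳ at path k) (take≡node k))

    ¬bar : ¬ (∃ λ n → Q (take n path))
    ¬bar (n , q) = proj₂ (node n) (subst Q (take≡node n) q)

  -- The Nash-Williams partition theorem

  infix 4 _⊑_
  _⊑_ : Inc → Inc → Set
  X ⊑ Y = ∀ i → ∃ λ j → at X i ≡ at Y j

  ⊑-refl : ∀ {X} → X ⊑ X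
  ⊑-refl i = i , refl

  ⊑-trans : ∀ {X Y Z} → X ⊑ Y → Y ⊑ Z → X ⊑ Z
  ⊑-trans X⊑Y Y⊑Z i = let j , p = X⊑Y i ; k , q = Y⊑Z j in k , trans p q

  tail-⊑ : ∀ {X} → tail X ⊑ X
  tail-⊑ i = suc i , refl

  module _ (C : Inc → Bool) (lcC : LocallyConstant C) where

    HomogeneousBelow : List ℕ → Inc → Bool → Set
    HomogeneousBelow p h b =
      ∀ Y → p ≡ take (length p) Y → (∀ i → ∃ λ j → at Y (length p + i) ≡ at h j) → C Y ≡ b

    -- Quantifying over all `h` makes the property usable inside whatever set a fusion has already
    -- reached.
    Homogenizable : List ℕ → Set
    Homogenizable p = ∀ h → ∃₂ λ h′ b → h′ ⊑ h × HomogeneousBelow p h′ b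

    -- Past the modulus of `C` at `X` the colour is decided, so every `h` is homogeneous as it
    -- stands.
    homogenizable-bar : ∀ X → ∃ λ n → Homogenizable (take n X)
    homogenizable-bar X = n , λ h → h , C X , ⊑-refl {h} , λ Y X≡Y _ →
        sym (C-const Y (applyUpTo-injective n
          (subst (λ k → take n X ≡ take k Y) (length-take n X) X≡Y)))
      where
      n = proj₁ (lcC X)
      C-const = proj₂ (lcC X)

    -- No infinite set begins with `p`, so the colour `true` is arbitrary.
    homogenizable-junk : ∀ {p} → ¬ Increasing p → Homogenizable p
    homogenizable-junk {p} ¬inc h = h , true , ⊑-refl {h} , λ Y p≡ _ →
      ⊥-elim (¬inc (subst Increasing (sym p≡) (take-increasing (length p) Y)))

    -- Each stage is homogeneous below `p` followed by the least element of the preceding stage.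
    -- These least elements form the diagonal, on which the colour depends only on the first entry
    -- after `p`.
    module Fusion (p : List ℕ) (ih : ∀ n → Homogenizable (p ∷ʳ n)) (h : Inc) where

      stage : ℕ → Inc
      stage zero    = h
      stage (suc i) = proj₁ (ih (at (stage i) 0) (tail (stage i)))

      colour : ℕ → Bool
      colour i = proj₁ (proj₂ (ih (at (stage i) 0) (tail (stage i))))

      stage-⊑ : ∀ i → stage (suc i) ⊑ tail (stage i)
      stage-⊑ i = proj₁ (proj₂ (proj₂ (ih (at (stage i) 0) (tail (stage i)))))

      stage-homogeneous : ∀ i → HomogeneousBelow (p ∷ʳ at (stage i) 0) (stage (suc i)) (colour i)
      stage-homogeneous i = proj₂ (proj₂ (proj₂ (ih (at (stage i) 0) (tail (stage i)))))

      stage-anti : ∀ {i j} → i ≤ j → stage j ⊑ stage i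
      stage-anti {j = zero} z≤n = ⊑-refl {h}
      stage-anti {i} {suc j} i≤1+j with m≤n⇒m<n∨m≡n i≤1+j
      ... | inj₂ refl = ⊑-refl {stage (suc j)}
      ... | inj₁ (s≤s i≤j) =
        ⊑-trans {stage (suc j)} {stage j} {stage i}
          (⊑-trans {stage (suc j)} {tail (stage j)} {stage j} (stage-⊑ j) (tail-⊑ {stage j}))
          (stage-anti i≤j)

      diagonal : Inc
      diagonal = enum (λ i → at (stage i) 0) λ i →
        let k , eq = stage-⊑ i 0
        in subst (at (stage i) 0 <_) (sym eq) (at-mono-< (stage i) z<s)

      diagonal-homogeneous : (g : Inc) (b : Bool) → (∀ i → colour (at g i) ≡ b) →
                             HomogeneousBelow p (diagonal ⊙ g) b
      diagonal-homogeneous g b colour≡b Y p≡ rest =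
        trans (stage-homogeneous m Y prefix later) (colour≡b k)
        where
        k = proj₁ (rest 0)
        m = at g k

        length≡ : length (p ∷ʳ at diagonal m) ≡ suc (length p)
        length≡ = trans (List.length-++ p) (+-comm (length p) 1)

        head≡ : at Y (length p) ≡ at diagonal m
        head≡ = trans (cong (at Y) (sym (+-identityʳ (length p)))) (proj₂ (rest 0))

        prefix : p ∷ʳ at diagonal m ≡ take (length (p ∷ʳ at diagonal m)) Y
        prefix = trans (cong₂ _∷ʳ_ p≡ (sym head≡))
          (trans (List.applyUpTo-∷ʳ (at Y) (length p)) (cong (λ n → take n Y) (sym length≡)))

        later : ∀ i → ∃ λ j → at Y (length (p ∷ʳ at diagonal m) + i) ≡ at (stage (suc m)) j
        later i = let j , eq = stage-anti m<gl 0 in j , trans Y≡ eq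
          where
          l = proj₁ (rest (suc i))
          Y≡ : at Y (length (p ∷ʳ at diagonal m) + i) ≡ at diagonal (at g l)
          Y≡ = trans (cong (at Y) (trans (cong (_+ i) length≡) (sym (+-suc (length p) i))))
                     (proj₂ (rest (suc i)))
          m<gl : m < at g l
          m<gl = at-cancel-< diagonal
            (subst₂ _<_ head≡ Y≡ (at-mono-< Y
              (subst (length p <_) (cong (_+ i) (sym length≡)) (s≤s (m≤m+n (length p) i)))))

      diagonal-⊑ : ∀ g → diagonal ⊙ g ⊑ h
      diagonal-⊑ g i = stage-anti (z≤n {at g i}) 0

    -- The stage colours are `true` infinitely often or `false` from some index on; the diagonal
    -- restricted to such indices is homogeneous.
    homogenizable-ind : ∀ p → (∀ n → Homogenizable (p ∷ʳ n)) → Homogenizable p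
    homogenizable-ind p ih h with frequently-or-finally-not (λ i → Fusion.colour p ih h i ≡ true)
    ... | inj₁ (g , true-on-g) = diagonal ⊙ g , true , diagonal-⊑ g , diagonal-homogeneous g true true-on-g
      where open Fusion p ih h
    ... | inj₂ (N , not-true) =
      diagonal ⊙ g , false , diagonal-⊑ g , diagonal-homogeneous g false λ i →
        not-true⇒false (not-true (subst (N ≤_) (sym (at-drop N ident i)) (m≤m+n N i)))
      where
      open Fusion p ih h
      g = drop N ident
      not-true⇒false : ∀ {b} → ¬ b ≡ true → b ≡ false
      not-true⇒false {true}  ¬t = ⊥-elim (¬t refl)
      not-true⇒false {false} _  = refl

    nash-williams : ∃₂ λ h b → ∀ X → C (h ⊙ X) ≡ b
    nash-williams =
      let h , b , _ , homogeneous = bar-induction Homogenizable homogenizable-bar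
                                      homogenizable-junk homogenizable-ind ident
      in h , b , λ X → homogeneous (h ⊙ X) refl (λ i → at X i , refl)

  nash-williams-rel : ∀ (R : A → B → Set ℓ) {F G} → LocallyConstant F → LocallyConstant G →
    ∃ λ h → (∀ X → R (F (h ⊙ X)) (G (h ⊙ X))) ⊎ (∀ X → ¬ R (F (h ⊙ X)) (G (h ⊙ X)))
  nash-williams-rel R {F} {G} lcF lcG
    with nash-williams (λ X → does (dec (R (F X) (G X))))
                       (lc-map₂ (λ x y → does (dec (R x y))) lcF lcG)
  ... | h , true , hom = h , inj₁ holds
    where
    holds : ∀ X → R (F (h ⊙ X)) (G (h ⊙ X))
    holds X with dec (R (F (h ⊙ X)) (G (h ⊙ X))) | hom X
    ... | yes r | _ = r
    ... | no _  | ()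
  ... | h , false , hom = h , inj₂ fails
    where
    fails : ∀ X → ¬ R (F (h ⊙ X)) (G (h ⊙ X))
    fails X with dec (R (F (h ⊙ X)) (G (h ⊙ X))) | hom X
    ... | no ¬r | _ = ¬r
    ... | yes _ | ()

  -- Barriers and locally constant maps

  module _ {A : Set a} {F : Inc → A} (lcF : LocallyConstant F) where

    private
      Modulus : ℕ → Inc → Set _
      Modulus n X = ∀ Y → X ≈[ n ] Y → F X ≡ F Y

      modulus-cong : ∀ {n X Y} → X ≈[ n ] Y → Modulus n X → Modulus n Y
      modulus-cong {n} {X} {Y} X≈Y mod Z Y≈Z = trans (sym (mod Y X≈Y)) (mod Z (≈[]-trans {n} {X} {Y} {Z} X≈Y Y≈Z))

      least-modulus : ∀ X → ∃ λ n → Modulus (suc n) X × (∀ {m} → m < n → ¬ Modulus (suc m) X)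
      least-modulus X = least (λ n → Modulus (suc n) X)
        (proj₁ (lcF X) , λ Y X≈Y → proj₂ (lcF X) Y λ i<n → X≈Y (<-trans i<n (n<1+n _)))

      length≤ : ∀ {X Y} → X ≈[ suc (proj₁ (least-modulus X)) ] Y → proj₁ (least-modulus Y) ≤ proj₁ (least-modulus X)
      length≤ {X} {Y} X≈Y = ≮⇒≥ λ m<n → proj₂ (proj₂ (least-modulus Y)) m<n
        (modulus-cong {X = X} {Y} X≈Y (proj₁ (proj₂ (least-modulus X))))

    -- `len X` is the least positive modulus of `F` at `X`. A modulus at `X` is also one at every
    -- `Y` that agrees with `X` that far, so minimality forces equal lengths.
    canonical-front : Front F
    canonical-front = record
      { len        = suc ∘ proj₁ ∘ least-modulus
      ; len-pos    = λ _ → z<s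
      ; determined = λ {X} {Y} X≈Y →
            cong suc (≤-antisym
              (length≤ {Y} {X} λ i<m → sym (X≈Y (<-≤-trans i<m (s≤s (length≤ {X} {Y} X≈Y)))))
              (length≤ {X} {Y} X≈Y))
          , proj₁ (proj₂ (least-modulus X)) Y X≈Y
      }

  module _ {A : Set a} {F : Inc → A} (fr : Front F) where

    open Front fr

    private
      Minimal : List ℕ → Set
      Minimal s = ∀ Y → ¬ (pre Y ⊂ₗ s)

      -- The entries of `pre Y` lie in the range of `h`; their positions, continued to an infinite
      -- set `Z`, make `h ⊙ Z` agree with `Y` on `len Y` entries.
      subsequence-realizing : ∀ h X Y → pre Y ⊆ₗ pre (h ⊙ X) → ∃ λ Z → pre (h ⊙ Z) ≡ pre Y
      subsequence-realizing h X Y Y⊆X = Z , sym (pre-cong Y≈hZ)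
        where
        position : ℕ → ℕ
        position y with dec (∃ λ j → y ≡ at h j)
        ... | yes (j , _) = j
        -- Arbitrary: only the first `len Y` entries of `Y` matter, and they have a position.
        ... | no _        = 0

        at-position : ∀ {i} → i < len Y → at Y i ≡ at h (position (at Y i))
        at-position {i} i<n with dec (∃ λ j → at Y i ≡ at h j)
        ... | yes (j , eq) = eq
        ... | no ¬∃ =
          let j , _ , eq = ∈-applyUpTo⁻ (at (h ⊙ X)) (Y⊆X (∈-applyUpTo⁺ (at Y) i<n))
          in contradiction (at X j , eq) ¬∃

        completion : ∃ λ Z → ∀ {i} → i < len Y → at Z i ≡ position (at Y i)
        completion = complete (len Y) (position ∘ at Y) λ {i} 1+i<n →
          at-cancel-< h (subst₂ _<_ (at-position (<-trans (n<1+n i) 1+i<n)) (at-position 1+i<n) (at-step Y i))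

        Z : Inc
        Z = proj₁ completion

        Y≈hZ : Y ≈[ len Y ] h ⊙ Z
        Y≈hZ i<n = trans (at-position i<n) (cong (at h) (sym (proj₂ completion i<n)))

    -- A non-minimal pre (h ⊙ X) contains a shorter segment pre Y, which is again of
    -- the form pre (h ⊙ Z): if no segment were minimal, this would descend forever.
    thinning : ∃ λ h → Thin (restrict h fr)
    thinning with nash-williams-rel (λ s _ → Minimal s) lc-pre lc-pre
    ... | h , inj₁ minimal = h , λ X Y X⊂Y → minimal Y (h ⊙ X) (map-⊂ X Y X⊂Y)
      where
      open Front (restrict h fr) using () renaming (pre to preₕ)

      map-pre : ∀ X → map (at h) (preₕ X) ≡ pre (h ⊙ X)
      map-pre X = List.map-applyUpTo (at X) (at h) (len (h ⊙ X))

      map-⊂ : ∀ X Y → preₕ X ⊂ₗ preₕ Y → pre (h ⊙ X) ⊂ₗ pre (h ⊙ Y)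
      map-⊂ X Y (X⊆Y , Y⊈X) = to , λ Y⊆X → Y⊈X (from Y⊆X)
        where
        to : pre (h ⊙ X) ⊆ₗ pre (h ⊙ Y)
        to z∈ with ∈-map⁻ (at h) (subst (_ ∈_) (sym (map-pre X)) z∈)
        ... | y , y∈ , refl = subst (_ ∈_) (map-pre Y) (∈-map⁺ (at h) (X⊆Y y∈))

        from : pre (h ⊙ Y) ⊆ₗ pre (h ⊙ X) → preₕ Y ⊆ₗ preₕ X
        from Y⊆X z∈ with ∈-map⁻ (at h) (subst (_ ∈_) (sym (map-pre X)) (Y⊆X (subst (_ ∈_) (map-pre Y) (∈-map⁺ (at h) z∈))))
        ... | y , y∈ , eq = subst (_∈ preₕ X) (≤-antisym (≮⇒≥ (absurd eq)) (≮⇒≥ (absurd (sym eq)))) y∈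
          where
          absurd : ∀ {m n} → at h m ≡ at h n → ¬ (m < n)
          absurd eq m<n = <-irrefl eq (at-mono-< h m<n)
    ... | h , inj₂ ¬minimal = ⊥-elim (descent ident (<-wellFounded _))
      where
      descent : ∀ X → Acc _<_ (len (h ⊙ X)) → ⊥
      descent X (acc rec) =
        let Y , ¬¬⊂ = ¬∀⇒∃¬ (¬minimal X)
            Y⊂X     = by-contradiction ¬¬⊂
            Z , eq  = subsequence-realizing h X Y (proj₁ Y⊂X)
            shorter = ⊂⇒length< (take-increasing (len Y) Y) (take-increasing (len (h ⊙ X)) (h ⊙ X)) Y⊂X
        in descent Z (rec (subst₂ _<_ (trans (cong length (sym eq)) (length-pre (h ⊙ Z)))
                                      (length-pre (h ⊙ X)) shorter))

  Infinite⇒unbounded : ∀ {X : Pred ℕ 0ℓ} → Infinite (setoid ℕ) X → ∀ N → ∃ λ m → N ≤ m × X m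
  Infinite⇒unbounded {X} inf N = by-contradiction λ bounded →
    inf (upTo N , λ {n} n∈X → ∈-upTo⁺ (≰⇒> λ N≤n → bounded (n , N≤n , n∈X)))

  enumerate : ∀ {X : Pred ℕ 0ℓ} → Infinite (setoid ℕ) X →
              ∃ λ x → (∀ i → X (at x i)) × (∀ {n} → X n → ∃ λ i → n ≡ at x i)
  enumerate {X} inf = x , x∈X , λ {n} n∈X → onto n∈X (suc n) (at-inflationary x (suc n))
    where
    abstract
      least-from : ∀ N → ∃ λ m → (N ≤ m × X m) × (∀ {k} → k < m → ¬ (N ≤ k × X k))
      least-from N = least (λ m → N ≤ m × X m) (Infinite⇒unbounded inf N)

    x : Inc
    x = iterate (λ n → proj₁ (least-from (suc n))) (λ n → proj₁ (proj₁ (proj₂ (least-from (suc n))))) (proj₁ (least-from 0))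

    x∈X : ∀ i → X (at x i)
    x∈X zero    = proj₂ (proj₁ (proj₂ (least-from 0)))
    x∈X (suc i) = proj₂ (proj₁ (proj₂ (least-from (suc (at x i)))))

    onto : ∀ {n} → X n → ∀ i → n < at x i → ∃ λ j → n ≡ at x j
    onto n∈X zero n<x = contradiction (z≤n , n∈X) (proj₂ (proj₂ (least-from 0)) n<x)
    onto {n} n∈X (suc i) n<x with n <? at x i
    ... | yes n<xi = onto n∈X i n<xi
    ... | no n≮xi with m≤n⇒m<n∨m≡n (≮⇒≥ n≮xi)
    ...   | inj₂ xi≡n = i , sym xi≡n
    ...   | inj₁ xi<n = contradiction (xi<n , n∈X) (proj₂ (proj₂ (least-from (suc (at x i)))) n<x)

  -- The barrier of a thin front and its order type.

  module FromFront {A : Set a} {F : Inc → A} (fr : Front F) (thin : Thin fr) where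

    open Front fr

    IsPre : List ℕ → Set
    IsPre s = ∃ λ X → s ≡ pre X

    barrier : Barrier
    barrier = record
      { Members      = IsPre
      ; increasing   = λ { (X , refl) → take-increasing (len X) X }
      ; infinite     = λ (xs , all) →
          -- `N` bounds all entries of all lists in `xs`, and `X` starts at `N + 1`.
          let N     = sum (map sum xs)
              X     = drop (suc N) ident
              X0∈   = ∈-applyUpTo⁺ (at X) (len-pos X)
              X0≤N  = ≤-trans (∈⇒≤sum X0∈) (∈⇒≤sum (∈-map⁺ sum (all (X , refl))))
          in <⇒≱ (subst (N <_) (sym (at-drop (suc N) ident 0)) (m≤m+n (suc N) 0)) X0≤N
      ; incomparable = λ { (X , refl) (Y , refl) → thin X Y }
      ; blocks       = λ X inf _ →
          let x , x∈X , onto = enumerate inf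
          in pre x , (x , refl) ,
             (λ pre≡[] → <-irrefl (trans (cong length (sym pre≡[])) (length-pre x)) (len-pos x)) ,
             (λ n∈pre → let i , _ , eq = ∈-applyUpTo⁻ (at x) n∈pre in subst X (sym eq) (x∈X i)) ,
             λ {m} {n} n∈pre m∈X m≤n →
               let i , i<l , n≡xi = ∈-applyUpTo⁻ (at x) n∈pre
                   j , m≡xj       = onto m∈X
                   j≤i = ≮⇒≥ λ i<j → <⇒≱ (at-mono-< x {i} {j} i<j) (subst₂ _≤_ m≡xj n≡xi m≤n)
               in subst (_∈ pre x) (sym m≡xj) (∈-applyUpTo⁺ (at x) (≤-<-trans j≤i i<l))
      }

    open Barrier barrier using (Element; _<lex_)

    isPre : ∀ (e : Element) → IsPre (value e)
    isPre (s Refinement., Irrelevant.[ s∈ ]) = recompute (dec (IsPre s)) s∈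

    -- Bar induction carries this property to `[]`, where its premise is vacuous and its conclusion
    -- covers all elements.
    AccessibleAbove : List ℕ → Set
    AccessibleAbove p = (∀ e → value e <ₗ p → Acc _<lex_ e) →
                        ∀ e {q} → value e ≡ p ++ q → Acc _<lex_ e

    -- A member of the barrier that extends `pre X` equals `pre X`, so whatever lies below it is
    -- accessible by assumption.
    accessible-bar : ∀ X → ∃ λ n → AccessibleAbove (take n X)
    accessible-bar X = len X , λ below e {q} e≡ →
      let Y , e≡preY = isPre e
          X≈Y = pre≡take⇒≈ {X} {Y} (prefix-of-take (pre X) {q} {len Y} {Y} (trans (sym e≡) e≡preY))
          e≡preX = trans e≡preY (sym (pre-cong {X} {Y} X≈Y))
      in acc λ {e′} e′<e → below e′ (subst (value e′ <ₗ_) e≡preX e′<e)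

    accessible-junk : ∀ {p} → ¬ Increasing p → AccessibleAbove p
    accessible-junk {p} ¬inc _ e e≡ =
      let Y , e≡preY = isPre e
      in ⊥-elim (¬inc (subst Increasing (sym (prefix-of-take p {n = len Y} {Y} (trans (sym e≡) e≡preY)))
                             (take-increasing (length p) Y)))

    accessible-ind : ∀ p → (∀ n → AccessibleAbove (p ∷ʳ n)) → AccessibleAbove p
    accessible-ind p ih below e {[]} e≡ =
      acc λ {e′} e′<e → below e′ (subst (value e′ <ₗ_) (trans e≡ (List.++-identityʳ p)) e′<e)
    accessible-ind p ih below e {n ∷ q} e≡ =
      ih n (below-∷ʳ n (<-wellFounded n)) e {q} (trans e≡ (sym (List.∷ʳ-++ p n q)))
      where
      below-∷ʳ : ∀ n → Acc _<_ n → ∀ e → value e <ₗ (p ∷ʳ n) → Acc _<lex_ e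
      below-∷ʳ n (acc rec) e e< with <ₗ-∷ʳ p e<
      ... | inj₁ e<p          = below e e<p
      ... | inj₂ (inj₁ refl)  = acc λ {e′} → below e′
      ... | inj₂ (inj₂ (m , q , m<n , e≡)) =
        ih m (below-∷ʳ m (rec m<n)) e {q} (trans e≡ (sym (List.∷ʳ-++ p m q)))

    <lex-wellFounded : WellFounded _<lex_
    <lex-wellFounded e =
      bar-induction AccessibleAbove accessible-bar accessible-junk accessible-ind
        (λ { _ (Lex.base ()) }) e refl

    orderType : CountableOrdinal
    orderType = record
      { strictTotalOrder = On.strictTotalOrder (Lex.<-strictTotalOrder <-strictTotalOrder) (value {P = IsPre})
      ; wellFounded      = <lex-wellFounded
      ; countable        = record
        { to        = code ∘ value
        ; cong      = cong code ∘ Pointwise-≡⇒≡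
        ; injective = ≡⇒Pointwise-≡ ∘ code-injective
        }
      }

    orderTypeAtMost : OrderTypeAtMost barrier orderType
    orderTypeAtMost = record
      { rank         = id
      ; rank-mono    = id
      ; rank-initial = λ {x} _ → x , ≡⇒Pointwise-≡ refl
      }

    -- By `determined` the choice of `X` does not matter; off the barrier the value is arbitrary.
    label : List ℕ → A
    label s with dec (IsPre s)
    ... | yes (X , _) = F X
    ... | no _        = F ident

    label-pre : ∀ {s X} → s ≡ take (length s) X → IsPre s → label s ≡ F X
    label-pre {s} {X} s≺X s∈ with dec (IsPre s)
    ... | yes (Y , refl) = proj₂ (determined (pre≡take⇒≈ {Y} {X} s≺X))
    ... | no s∉ = contradiction s∈ s∉

  module _ (Q : Preorder c ℓ₁ ℓ₂) where

    open Preorder Q using (Carrier; _≲_)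

    -- With `t` equal to `pre Y`, the set `Z` obtained by putting `n` in front of `Y` has `s` as an
    -- initial segment and `Y` as its tail, so `s` and `t` carry the labels `F Z` and `F (tail Z)`.
    good-tail : ∀ {F : Inc → Carrier} (fr : Front F) (thin : Thin fr) → let open FromFront fr thin in
                Good Q barrier (label ∘ value) → ∃ λ X → F X ≲ F (tail X)
    good-tail {F} fr thin (s , t , (r , inc-r , (s-prefix , _) , n , r≡n∷t) , fs≲ft) =
      Z , subst₂ _≲_ (label-pre {X = Z} s≺Z (isPre s)) (label-pre {X = Y} t≺Y (isPre t)) fs≲ft
      where
      open Front fr
      open FromFront fr thin

      Y : Inc
      Y = proj₁ (isPre t)

      t≡preY : value t ≡ pre Y
      t≡preY = proj₂ (isPre t)

      n<Y0 : n < at Y 0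
      n<Y0 = increasing-head (subst Increasing r≡n∷t inc-r)
               (subst (at Y 0 ∈_) (sym t≡preY) (∈-applyUpTo⁺ (at Y) (len-pos Y)))

      Z : Inc
      Z = cons n Y n<Y0

      s≺Z : value s ≡ take (length (value s)) Z
      s≺Z = let q , s++q≡r = Prefix⇒++ s-prefix
            in prefix-of-take (value s) {q} {suc (len Y)} {Z}
                 (trans s++q≡r (trans r≡n∷t (cong (n ∷_) t≡preY)))

      t≺Y : value t ≡ take (length (value t)) Y
      t≺Y = prefix-of-take (value t) {[]} {len Y} {Y} (trans (List.++-identityʳ (value t)) t≡preY)

    Bqo⇒BqoSeq : Bqo Q → BqoSeq Q
    Bqo⇒BqoSeq bqo F lcF = h ⊙ proj₁ good , proj₂ good
      where
      fr : Front F
      fr = canonical-front lcF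

      h : Inc
      h = proj₁ (thinning fr)

      thin : Thin (restrict h fr)
      thin = proj₂ (thinning fr)

      open FromFront (restrict h fr) thin

      good : ∃ λ X → F (h ⊙ X) ≲ F (h ⊙ tail X)
      good = good-tail (restrict h fr) thin (bqo orderType barrier orderTypeAtMost (label ∘ value))

  -- From maps on a barrier to locally constant maps.

  module _ (B : Barrier) where

    open Barrier B

    incomparable⇒≡ : ∀ {s t} → Members s → Members t → s ⊆ₗ t → s ≡ t
    incomparable⇒≡ s∈ t∈ s⊆t = ⊆-antisym
      (⊆⇒Sublist (increasing s∈) (increasing t∈) s⊆t)
      (⊆⇒Sublist (increasing t∈) (increasing s∈)
        (by-contradiction λ t⊈s → incomparable s∈ t∈ (s⊆t , t⊈s)))

    -- If the union were finite, all members would be among the finitely many sublists of one list.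
    ⋃-infinite : Infinite (setoid ℕ) (⋃ Members)
    ⋃-infinite (ns , ⋃⊆ns) = infinite (sublists (upTo N) , λ {s} s∈ →
      Sublist⇒∈sublists (⊆⇒Sublist (increasing s∈) (take-increasing N ident) λ n∈s →
        ∈-upTo⁺ (s≤s (∈⇒≤sum (⋃⊆ns (s , s∈ , n∈s))))))
      where
      N = suc (sum ns)

    -- `blocks` concerns only subsets of `⋃ Members`; composing with its enumeration turns every `X`
    -- into such a subset.
    support : Inc
    support = proj₁ (enumerate ⋃-infinite)

    abstract
      block : ∀ X → ∃ λ s → Members s × s ≡ take (length s) (support ⊙ X)
      block X =
        let s , s∈ , _ , initial = blocks (range (support ⊙ X)) (range-infinite (support ⊙ X))
              λ { (i , refl) → proj₁ (proj₂ (enumerate ⋃-infinite)) (at X i) }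
        in s , s∈ , initialSegment⇒take (support ⊙ X) (increasing s∈) initial

    take⇒Prefix : ∀ {s t} X → s ≡ take (length s) X → t ≡ take (length t) X → length s ≤ length t → Prefix _≡_ s t
    take⇒Prefix X s≺X t≺X s≤t = subst₂ (Prefix _≡_) (sym s≺X) (sym t≺X) (take-Prefix (at X) s≤t)

    -- Two initial segments of one set are nested, and nested members of a barrier are equal.
    block-unique : ∀ {s t} X → Members s → Members t →
                   s ≡ take (length s) X → t ≡ take (length t) X → s ≡ t
    block-unique {s} {t} X s∈ t∈ s≺X t≺X with ≤-total (length s) (length t)
    ... | inj₁ s≤t = incomparable⇒≡ s∈ t∈ (Prefix⇒⊆ (take⇒Prefix X s≺X t≺X s≤t))
    ... | inj₂ t≤s = sym (incomparable⇒≡ t∈ s∈ (Prefix⇒⊆ (take⇒Prefix X t≺X s≺X t≤s)))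

    element : Inc → Element
    element X = let s , s∈ , _ = block X in s Refinement., Irrelevant.[ s∈ ]

    lc-element : LocallyConstant element
    lc-element X = length s , λ Y X≈Y →
      let t , t∈ , t≺Y = block Y
      in value-injective (block-unique (support ⊙ Y) s∈ t∈
           (trans s≺X (applyUpTo-cong (length s) (cong (at support) ∘ X≈Y))) t≺Y)
      where
      s = proj₁ (block X)
      s∈ = proj₁ (proj₂ (block X))
      s≺X = proj₂ (proj₂ (block X))

    -- Both `s` and `r` are initial segments of `W`. If `s` were at least as long as `r`, then `t`
    -- would be contained in `s`, hence equal to it, although `t` is shorter than `r`.
    element-◁ : ∀ X → value (element X) ◁ value (element (tail X))
    element-◁ X = r , subst Increasing (sym r≺W) (take-increasing (length r) W) , (s-prefix , s≢r) , at W 0 , refl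
      where
      W = support ⊙ X
      s = proj₁ (block X)
      s∈ = proj₁ (proj₂ (block X))
      s≺W = proj₂ (proj₂ (block X))
      t = proj₁ (block (tail X))
      t∈ = proj₁ (proj₂ (block (tail X)))
      r = at W 0 ∷ t
      r≺W : r ≡ take (length r) W
      r≺W = cong (at W 0 ∷_) (proj₂ (proj₂ (block (tail X))))

      t⊈s : length r ≤ length s → ¬ (t ⊆ₗ s)
      t⊈s r≤s t⊆s = <⇒≱ r≤s (≤-reflexive (cong length (sym (incomparable⇒≡ t∈ s∈ t⊆s))))

      s-prefix : Prefix _≡_ s r
      s-prefix with ≤-total (length s) (length r)
      ... | inj₁ s≤r = take⇒Prefix W s≺W r≺W s≤r
      ... | inj₂ r≤s = ⊥-elim (t⊈s r≤s λ z∈t → Prefix⇒⊆ (take⇒Prefix W r≺W s≺W r≤s) (there z∈t))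

      s≢r : s ≢ r
      s≢r s≡r = t⊈s (≤-reflexive (cong length (sym s≡r))) λ z∈t → subst (_ ∈_) (sym s≡r) (there z∈t)

  BqoSeq⇒Bqo : (Q : Preorder c ℓ₁ ℓ₂) → BqoSeq Q → Bqo Q
  BqoSeq⇒Bqo Q bqoSeq α B _ f =
    let X , good = bqoSeq (f ∘ element B) (λ X → let n , const = lc-element B X in n , λ Y X≈Y → cong f (const Y X≈Y))
    in element B X , element B (tail X) , element-◁ B X , good

  -- The quasi-orders ≤pred and ≤succ and maximal antichains

  module Order {c ℓ₁ ℓ₂} (P : Poset c ℓ₁ ℓ₂) where

    open Poset P using (_≈_; module Eq; reflexive; antisym)
      renaming (Carrier to E; _≤_ to _≼_; refl to ≼-refl; trans to ≼-trans)
    open PosetProperties P using ()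
      renaming (_<_ to _≺_; <-trans to ≺-trans; <-respʳ-≈ to ≺-respʳ-≈; ≤⇒≯ to ≼⇒⊁)

    ≼-≺-trans : ∀ {x y z} → x ≼ y → y ≺ z → x ≺ z
    ≼-≺-trans x≤y y<z =
      ≼-trans x≤y (proj₁ y<z) , λ x≈z → ≼⇒⊁ (≼-trans (reflexive (Eq.sym x≈z)) x≤y) y<z

    ≺-≼-trans : ∀ {x y z} → x ≺ y → y ≼ z → x ≺ z
    ≺-≼-trans x<y y≤z =
      ≼-trans (proj₁ x<y) y≤z , λ x≈z → ≼⇒⊁ (≼-trans y≤z (reflexive (Eq.sym x≈z))) x<y

    ≺-irrefl : ∀ {x} → ¬ x ≺ x
    ≺-irrefl = ≼⇒⊁ ≼-refl

    ≼⇒≤pred : ∀ {x y} → x ≼ y → _≤pred_ P x y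
    ≼⇒≤pred x≼y z z≺x = ≺-≼-trans z≺x x≼y

    ≼⇒≤succ : ∀ {x y} → x ≼ y → _≤succ_ P x y
    ≼⇒≤succ x≼y z y≺z = ≼-≺-trans x≼y y≺z

    pred⇒succ : BqoSeq (predPreorder P) → BqoSeq (succPreorder P)
    pred⇒succ bqo F lcF = by-contradiction λ bad →
      let X , good = bqo (λ X → pick (F X) (F (tail X))) (lc-map₂ pick lcF (lc-tail lcF))
          above , _ = pick-spec (λ good′ → bad (X , good′))
          _ , ⊀     = pick-spec (λ good′ → bad (tail X , good′))
      -- `F (tail X)` lies strictly below the value picked at `X` but not below the one picked at
      -- `tail X`.
      in ⊀ (good _ above)
      where
      pick : E → E → E
      pick a b with dec (∃ λ y → b ≺ y × ¬ a ≺ y)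
      ... | yes (y , _) = y
      -- Reached only when `a` is `≤succ`-below `b`, which a bad `F` rules out for the pairs used.
      ... | no _        = a

      pick-spec : ∀ {a b} → ¬ _≤succ_ P a b → b ≺ pick a b × ¬ a ≺ pick a b
      pick-spec {a} {b} a≰b with dec (∃ λ y → b ≺ y × ¬ a ≺ y)
      ... | yes (y , spec) = spec
      ... | no ¬∃ = ⊥-elim (a≰b λ y b<y → by-contradiction λ a≮y → ¬∃ (y , b<y , a≮y))

    P⇒AM : BqoSeq (Poset.preorder P) → BqoSeq (Poset.preorder (AM P))
    P⇒AM bqo F lcF = by-contradiction λ ¬good →
      let bad = λ X → λ (F≤F : proj₁ (F X) ≤dom′ proj₁ (F (tail X))) → ¬good (X , λ {x} → F≤F {x})
          -- `pick` needs some element of `E` to be total; badness at `ident` supplies one.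
          default , _ = outside (F ident) (F (tail ident)) (bad ident)
          X , good = bqo (λ X → pick default (F X) (F (tail X)))
                         (lc-map₂ (pick default) lcF (lc-tail lcF))
          _ , not-below = pick-spec default (F X) (F (tail X)) (bad X)
          member , _    = pick-spec default (F (tail X)) (F (tail (tail X))) (bad (tail X))
      in not-below _ member good
      where
      MaxAntichain = Poset.Carrier (AM P)

      _≤dom′_ = _≤dom_ P

      Outside : MaxAntichain → MaxAntichain → E → Set _
      Outside U V x = proj₁ U x × (∀ y → proj₁ V y → ¬ x ≼ y)

      outside : ∀ U V → ¬ proj₁ U ≤dom′ proj₁ V → ∃ (Outside U V)
      outside U V U≰V = by-contradiction λ ¬∃ → U≰V λ {x} x∈U →
        by-contradiction λ ¬below → ¬∃ (x , x∈U , λ y y∈V x≤y → ¬below (y , y∈V , x≤y))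

      pick : E → MaxAntichain → MaxAntichain → E
      pick default U V with dec (∃ (Outside U V))
      ... | yes (x , _) = x
      ... | no _        = default

      pick-spec : ∀ default U V → ¬ proj₁ U ≤dom′ proj₁ V → Outside U V (pick default U V)
      pick-spec default U V U≰V with dec (∃ (Outside U V))
      ... | yes (x , spec) = spec
      ... | no ¬∃          = contradiction (outside U V U≰V) ¬∃

    -- From `≤succ` back to the order of `P`, without infinite antichains.

    module _ (no-infinite-antichain : NoInfiniteAntichain P) where

      -- Otherwise the values of `a` form an antichain, and a finite cover of it would identify two
      -- of them by the pigeonhole principle, making them comparable.
      comparable-pair : (a : ℕ → E) → ∃₂ λ i j → i < j × (a i ≼ a j ⊎ a j ≼ a i)
      comparable-pair a = by-contradiction λ incomparable →
        no-infinite-antichain (values , antichain incomparable , infinite incomparable)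
        where
        values : Subset P
        values z = Lift (c Level.⊔ ℓ₁ Level.⊔ ℓ₂) (∃ λ i → z ≈ a i)

        transport : ∀ {x y x′ y′} → x ≈ x′ → y ≈ y′ → x ≼ y → x′ ≼ y′
        transport x≈x′ y≈y′ x≤y = ≼-trans (reflexive (Eq.sym x≈x′)) (≼-trans x≤y (reflexive y≈y′))

        antichain : ¬ (∃₂ λ i j → i < j × (a i ≼ a j ⊎ a j ≼ a i)) → IsAntichain P values
        antichain incomparable (lift (i , x≈ai)) (lift (j , y≈aj)) x≤y with <-cmp i j
        ... | tri< i<j _ _  = contradiction (i , j , i<j , inj₁ (transport x≈ai y≈aj x≤y)) incomparable
        ... | tri≈ _ refl _ = Eq.trans x≈ai (Eq.sym y≈aj)
        ... | tri> _ _ j<i  = contradiction (j , i , j<i , inj₂ (transport x≈ai y≈aj x≤y)) incomparable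

        infinite : ¬ (∃₂ λ i j → i < j × (a i ≼ a j ⊎ a j ≼ a i)) → Infinite Eq.setoid values
        infinite incomparable (zs , cover) =
          let covered = λ (k : Fin (suc (length zs))) → cover {a (toℕ k)} (lift (toℕ k , Eq.refl))
              i , j , i<j , same = pigeonhole (n<1+n (length zs)) (index ∘ covered)
              ai≈aj = Eq.trans (lookup-index (covered i))
                (Eq.trans (Eq.reflexive (cong (lookup zs) same)) (Eq.sym (lookup-index (covered j))))
          in incomparable (toℕ i , toℕ j , i<j , inj₁ (reflexive ai≈aj))

      StrictlyIncreasing : (ℕ → E) → Set _
      StrictlyIncreasing a = ∀ {i j} → i < j → a i ≺ a j

      -- Ramsey's theorem for the colouring `b i ≺ b j`. The negative colour would leave no
      -- comparable pair, as the hypothesis excludes equal and descending ones.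
      increasing-subsequence : (b : ℕ → E) → (∀ {i j} → i < j → ¬ b j ≼ b i) →
                               ∃ λ (g : Inc) → StrictlyIncreasing (b ∘ at g)
      increasing-subsequence b ⋠ with nash-williams-rel _≺_ (lc-at b 0) (lc-at b 1)
      ... | h , inj₁ rising = h , λ {i} {j} i<j → rising (fromTwo i j i<j)
      ... | h , inj₂ ⊀ with comparable-pair (b ∘ at h)
      ...   | i , j , i<j , inj₂ bj≤bi = contradiction bj≤bi (⋠ (at-mono-< h i<j))
      ...   | i , j , i<j , inj₁ bi≤bj = contradiction
              (bi≤bj , λ bi≈bj → ⋠ (at-mono-< h i<j) (reflexive (Eq.sym bi≈bj)))
              (⊀ (fromTwo i j i<j))

      -- If i < j and b j ≤ b i, then b j ≤ b i < a j, because b i ≤succ a i < a j.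
      increasing-below : (a b : ℕ → E) → StrictlyIncreasing a →
                         (∀ i → _≤succ_ P (b i) (a i)) → (∀ i → ¬ b i ≼ a i) →
                         ∃ λ (g : Inc) → StrictlyIncreasing (b ∘ at g)
      increasing-below a b a< b≤succa b≰a = increasing-subsequence b λ {i} {j} i<j bj≤bi →
        b≰a j (≼-trans bj≤bi (proj₁ (b≤succa i (a j) (a< i<j))))

      module _ {G : Inc → E}
               (≤succ-tail : ∀ X → _≤succ_ P (G X) (G (tail X)))
               (≰-tail : ∀ X → ¬ G X ≼ G (tail X)) where

        ≤succ-drop : ∀ n X → _≤succ_ P (G X) (G (drop n X))
        ≤succ-drop zero    X y lt = lt
        ≤succ-drop (suc n) X y lt = ≤succ-tail X y (≤succ-drop n (tail X) y lt)

        ≯-drop : ∀ n X → ¬ G (drop n X) ≺ G X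
        ≯-drop n X lt = ≺-irrefl (≤succ-drop n X (G X) lt)

        -- One use of `increasing-below` per dropped entry, each at the cost of passing to a
        -- subsequence.
        pull-back : ∀ n (Y : ℕ → Inc) → StrictlyIncreasing (G ∘ drop n ∘ Y) →
                    ∃ λ (g : Inc) → StrictlyIncreasing (G ∘ Y ∘ at g)
        pull-back zero    Y incr = ident , incr
        pull-back (suc n) Y incr =
          let g , incr-tail = pull-back n (tail ∘ Y) incr
              g′ , incr′ = increasing-below (G ∘ tail ∘ Y ∘ at g) (G ∘ Y ∘ at g) incr-tail
                             (λ i → ≤succ-tail (Y (at g i))) (λ i → ≰-tail (Y (at g i)))
          in g ⊙ g′ , incr′

        module _ (fr : Front G) where

          open Front fr

          -- By `spread`, thinned-out tails of `ident` have values none of which is below a later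
          -- one. A comparable pair among them then descends strictly, against `≯-drop`.
          ¬homogeneously-≰ : ¬ (∀ X → ¬ G X ≼ G (drop (len X) X))
          ¬homogeneously-≰ hom with thin-out (λ i m → i < m × ¬ G (drop i ident) ≼ G (drop m ident)) eventually
            where
            eventually : ∀ i → ∃ λ N → ∀ {m} → N ≤ m → i < m × ¬ G (drop i ident) ≼ G (drop m ident)
            eventually i = i + len (drop i ident) , λ {m} N≤m →
              let i<m = <-≤-trans (m<m+n i (len-pos (drop i ident))) N≤m
              in i<m , λ le → spread fr (λ x y → ¬ x ≼ y) hom (drop i ident)
                   (subst (_≤ m ∸ i) (m+n∸m≡n i _) (∸-monoˡ-≤ i N≤m))
                   (subst (λ Z → G (drop i ident) ≼ G Z) (drop-∸ ident (<⇒≤ i<m)) le)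
          ... | g , R with comparable-pair (λ i → G (drop (at g i) ident))
          ...   | i , j , i<j , inj₁ ai≤aj = proj₂ (R i<j) ai≤aj
          ...   | i , j , i<j , inj₂ aj≤ai =
            ≯-drop (at g j ∸ at g i) (drop (at g i) ident)
              (subst (λ Z → G Z ≺ G (drop (at g i) ident)) (drop-∸ ident (<⇒≤ (proj₁ (R i<j))))
                (aj≤ai , λ aj≈ai → proj₂ (R i<j) (reflexive (Eq.sym aj≈ai))))

          module _ (hom : ∀ X → G X ≼ G (drop (len X) X)) where

            -- Equality would give G X ≼ G (drop m X) ≼ G (tail X).
            tail-≺ : ∀ X {m} → len X ≤ m → suc (len (tail X)) ≤ m → G (tail X) ≺ G (drop m X)
            tail-≺ X {suc m} l≤m (s≤s l≤) =
              spread fr _≼_ hom (tail X) l≤ , λ eq →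
                ≰-tail X (≼-trans (spread fr _≼_ hom X l≤m) (reflexive (Eq.sym eq)))

            eventually-above : ∀ k → ∃ λ N → ∀ {m} → N ≤ m → G (drop (suc k) ident) ≺ G (drop m ident)
            eventually-above k = k + N , λ {m} k+N≤m →
              let k≤m = ≤-trans (m≤m+n k N) k+N≤m
                  N≤m∸k = subst (_≤ m ∸ k) (m+n∸m≡n k N) (∸-monoˡ-≤ k k+N≤m)
              in subst₂ (λ Y Z → G Y ≺ G Z) (drop-tail k ident) (sym (drop-∸ ident k≤m))
                   (tail-≺ (drop k ident) (≤-trans (m≤m⊔n _ _) N≤m∸k) (≤-trans (m≤n⊔m _ _) N≤m∸k))
              where
              -- The larger of the two thresholds of `tail-≺` at `drop k ident`.
              N = len (drop k ident) ⊔ suc (len (tail (drop k ident)))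

            increasing-drops : ∃ λ (g : Inc) → StrictlyIncreasing (λ i → G (drop (len ident + at g i) ident))
            increasing-drops = thin-out (λ i m → G (drop (len ident + i) ident) ≺ G (drop (len ident + m) ident))
              -- `eventually-above` compares proper tails only, so the number of dropped entries
              -- must be a successor; `len-pos` ensures this.
              λ i → let k , k≡ = positive (len ident + i) (<-≤-trans (len-pos ident) (m≤m+n _ i))
                        N , above = eventually-above k
                    in N , λ {m} N≤m → subst (λ l → G (drop l ident) ≺ G (drop (len ident + m) ident)) (sym k≡)
                                         (above (≤-trans N≤m (m≤n+m m (len ident))))
              where
              positive : ∀ n → 0 < n → ∃ λ k → n ≡ suc k
              positive (suc k) _ = k , refl

            ¬homogeneously-≤ : ⊥
            ¬homogeneously-≤ =
              let g , incr = increasing-drops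
                  -- All `Y i` share their first `len ident` entries, which fixes `G (Y i)`, while
                  -- their remainders have strictly increasing values.
                  Y = λ i → ident ⊙ skip (len ident) (at g i)
                  g′ , incr′ = pull-back (len ident) Y λ {i} {j} i<j →
                    subst₂ (λ U V → G U ≺ G V) (sym (drop-skip (len ident) (at g i) ident))
                      (sym (drop-skip (len ident) (at g j) ident)) (incr i<j)
                  constant = λ i → proj₂ (determined {ident} {Y i} λ i<l → sym (at-skip (len ident) (at g i) i<l))
              in ≺-irrefl (subst₂ _≺_ (sym (constant (at g′ 0))) (sym (constant (at g′ 1))) (incr′ z<s))

      -- The partition theorem decides whether `G X` is below the value at `X` without its first
      -- `len X` entries; each answer is refuted separately.
      ¬incomparable-≤succ-tails : ∀ {G : Inc → E} → LocallyConstant G → Front G →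
        (∀ X → _≤succ_ P (G X) (G (tail X))) → ¬ (∀ X → ¬ G X ≼ G (tail X))
      ¬incomparable-≤succ-tails {G} lcG fr ≤succ-tail ≰-tail
        with nash-williams-rel _≼_ lcG (lc-drop lcG (Front.lc-len fr))
      ... | k , inj₁ hom = ¬homogeneously-≤ {G ∘ (k ⊙_)} (≤succ-tail ∘ (k ⊙_)) (≰-tail ∘ (k ⊙_)) (restrict k fr)
          λ X → subst (λ Z → G (k ⊙ X) ≼ G Z) (drop-⊙ (Front.len fr (k ⊙ X)) k X) (hom X)
      ... | k , inj₂ hom = ¬homogeneously-≰ {G ∘ (k ⊙_)} (≤succ-tail ∘ (k ⊙_)) (≰-tail ∘ (k ⊙_)) (restrict k fr)
          λ X → subst (λ Z → ¬ G (k ⊙ X) ≼ G Z) (drop-⊙ (Front.len fr (k ⊙ X)) k X) (hom X)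

      succ⇒P : BqoSeq (succPreorder P) → BqoSeq (Poset.preorder P)
      succ⇒P bqo F lcF with nash-williams-rel (_≤succ_ P) lcF (lc-tail lcF)
      ... | h , inj₂ bad = let X , good = bqo (F ∘ (h ⊙_)) (lc-⊙ h lcF) in contradiction good (bad X)
      ... | h , inj₁ ≤succ-tail = by-contradiction λ bad →
        ¬incomparable-≤succ-tails {F ∘ (h ⊙_)} (lc-⊙ h lcF) (canonical-front (lc-⊙ h lcF)) ≤succ-tail
          λ X le → bad (h ⊙ X , le)

      -- Maximal antichains and the passage from `AM P` to `≤pred`.

      Comparable : E → E → Set _
      Comparable y z = y ≼ z ⊎ z ≼ y

      FiniteAntichain : Set _
      FiniteAntichain = ∃ λ ys → ∀ {y z} → y ∈ ys → z ∈ ys → y ≼ z → y ≈ z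

      ComparableWith : List E → E → Set _
      ComparableWith ys z = ∃ λ y → y ∈ ys × Comparable y z

      add-incomparable : ∀ (ys : FiniteAntichain) z → ¬ ComparableWith (proj₁ ys) z → FiniteAntichain
      add-incomparable (ys , antichain) z fresh = z ∷ ys , λ where
        (here refl) (here refl) _   → Eq.refl
        (here refl) (there w∈)  z≤w → contradiction (_ , w∈ , inj₂ z≤w) fresh
        (there y∈)  (here refl) y≤z → contradiction (_ , y∈ , inj₁ y≤z) fresh
        (there y∈)  (there w∈)  y≤w → antichain y∈ w∈ y≤w

      -- If adding incomparable elements to `x` never stopped, the added elements would form a
      -- sequence without a comparable pair.
      saturated-antichain : ∀ x → ∃ λ (ys : FiniteAntichain) → x ∈ proj₁ ys × (∀ z → ComparableWith (proj₁ ys) z)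
      saturated-antichain x = by-contradiction impossible
        where
        Stage : Set _
        Stage = ∃ λ (ys : FiniteAntichain) → x ∈ proj₁ ys

        start : Stage
        start = (x ∷ [] , λ { (here refl) (here refl) _ → Eq.refl }) , here refl

        module _ (fresh : (s : Stage) → ∃ λ z → ¬ ComparableWith (proj₁ (proj₁ s)) z) where

          add : Stage → Stage
          add s = add-incomparable (proj₁ s) (proj₁ (fresh s)) (proj₂ (fresh s)) , there (proj₂ s)

          stage : ℕ → Stage
          stage = fold start add

          entry : ℕ → E
          entry n = proj₁ (fresh (stage n))

          entry∈ : ∀ {i j} → i < j → entry i ∈ proj₁ (proj₁ (stage j))
          entry∈ {i} {suc j} (s≤s i≤j) with m≤n⇒m<n∨m≡n i≤j
          ... | inj₁ i<j  = there (entry∈ i<j)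
          ... | inj₂ refl = here refl

          absurd : ⊥
          absurd = let i , j , i<j , comparable = comparable-pair entry
                   in proj₂ (fresh (stage j)) (entry i , entry∈ i<j , comparable)

        impossible : ¬ ¬ (∃ λ (ys : FiniteAntichain) → x ∈ proj₁ ys × (∀ z → ComparableWith (proj₁ ys) z))
        impossible none = absurd λ (ys , x∈ys) → ¬∀⇒∃¬ λ saturated → none (ys , x∈ys , saturated)

      -- An element of a larger antichain is comparable with some `y` in `ys`, hence equivalent to
      -- it; this is why the set is closed under `≈`.
      closure-maximal : (ys : FiniteAntichain) → (∀ z → ComparableWith (proj₁ ys) z) →
                        IsMaximalAntichain P (λ z → Lift (c Level.⊔ ℓ₁ Level.⊔ ℓ₂) (∃ λ y → y ∈ proj₁ ys × z ≈ y))
      closure-maximal (ys , antichain) saturated = closure-antichain , maximal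
        where
        U : Subset P
        U z = Lift (c Level.⊔ ℓ₁ Level.⊔ ℓ₂) (∃ λ y → y ∈ ys × z ≈ y)

        closure-antichain : IsAntichain P U
        closure-antichain (lift (_ , y∈ , x≈y)) (lift (_ , z∈ , w≈z)) x≤w =
          Eq.trans x≈y (Eq.trans
            (antichain y∈ z∈ (≼-trans (reflexive (Eq.sym x≈y)) (≼-trans x≤w (reflexive w≈z))))
            (Eq.sym w≈z))

        maximal : ∀ V → IsAntichain P V → (∀ {z} → U z → V z) → ∀ {z} → V z → U z
        maximal V V-antichain U⊆V {z} z∈V with saturated z
        ... | y , y∈ , inj₁ y≤z = lift (y , y∈ , Eq.sym (V-antichain (U⊆V (lift (y , y∈ , Eq.refl))) z∈V y≤z))
        ... | y , y∈ , inj₂ z≤y = lift (y , y∈ , V-antichain z∈V (U⊆V (lift (y , y∈ , Eq.refl))) z≤y)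

      maximal-antichain-through : ∀ x → ∃ λ (U : Poset.Carrier (AM P)) → proj₁ U x
      maximal-antichain-through x =
        let ys , x∈ys , saturated = saturated-antichain x
        in (_ , closure-maximal ys saturated) , lift (x , x∈ys , Eq.refl)

      module _ (bqo : BqoSeq (Poset.preorder (AM P))) where

        -- For maximal antichains through the terms, a good pair puts a term below some `v` of the
        -- antichain through a later, smaller term. That smaller term is then below `v`, hence
        -- equivalent to it: a contradiction.
        no-descending-sequence : ∀ (a : ℕ → E) → ¬ (∀ i → a (suc i) ≺ a i)
        no-descending-sequence a descending =
          let X , good       = bqo (U ∘ a ∘ (λ X → at X 0)) (lc-at (U ∘ a) 0)
              v , v∈ , aX0≤v = good (through (a (at X 0)))
              aX1<aX0        = descends (at-mono-< X z<s)
              aX1≈v          = proj₁ (proj₂ (U (a (at X 1)))) (through (a (at X 1))) v∈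
                                 (≼-trans (proj₁ aX1<aX0) aX0≤v)
          in ≼⇒⊁ (≼-trans aX0≤v (reflexive (Eq.sym aX1≈v))) aX1<aX0
          where
          U : E → Poset.Carrier (AM P)
          U x = proj₁ (maximal-antichain-through x)

          through : ∀ x → proj₁ (U x) x
          through x = proj₂ (maximal-antichain-through x)

          descends : ∀ {i j} → i < j → a j ≺ a i
          descends {i} {suc j} (s≤s i≤j) with m≤n⇒m<n∨m≡n i≤j
          ... | inj₁ i<j  = ≺-trans (descending j) (descends i<j)
          ... | inj₂ refl = descending i

        minimal-below : ∀ (U : E → Set ℓ) {x} → U x → ∃ λ m → m ≼ x × U m × (∀ {z} → z ≺ m → ¬ U z)
        minimal-below U {x} x∈U = by-contradiction λ none →
          let smaller : (s : ∃ λ y → y ≼ x × U y) → ∃ λ (t : ∃ λ y → y ≼ x × U y) → proj₁ t ≺ proj₁ s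
              smaller (y , y≤x , y∈U) = by-contradiction λ ¬smaller →
                none (y , y≤x , y∈U , λ {z} z<y z∈U →
                  ¬smaller ((z , ≼-trans (proj₁ z<y) y≤x , z∈U) , z<y))
              stage = fold (x , ≼-refl , x∈U) (proj₁ ∘ smaller)
          in no-descending-sequence (proj₁ ∘ stage) λ i → proj₂ (smaller (stage i))

        -- The set A(x): the second condition is minimality in {z ∣ z ⊀ x}.
        Frontier : E → Subset P
        Frontier x z = ¬ z ≺ x × (∀ w → w ≺ z → w ≺ x)

        x∈Frontier : ∀ x → Frontier x x
        x∈Frontier x = ≺-irrefl , λ _ w<x → w<x

        Frontier-antichain : ∀ x → IsAntichain P (Frontier x)
        Frontier-antichain x (y≮x , _) (_ , below-z) y≤z =
          by-contradiction λ y≉z → y≮x (below-z _ (y≤z , y≉z))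

        below-Frontier : ∀ x {y} → ¬ y ≺ x → ∃ λ m → m ≼ y × Frontier x m
        below-Frontier x y≮x =
          let m , m≤y , m≮x , minimal = minimal-below (λ z → ¬ z ≺ x) y≮x
          in m , m≤y , m≮x , λ w w<m → by-contradiction (minimal w<m)

        -- In a larger antichain no `z` is strictly below `x`, as `x` is a member; so `z` has a
        -- frontier element below it and is equivalent to it.
        Frontier-maximal : ∀ x → IsMaximalAntichain P (Frontier x)
        Frontier-maximal x = Frontier-antichain x , maximal
          where
          maximal : ∀ V → IsAntichain P V → (∀ {z} → Frontier x z → V z) → ∀ {z} → V z → Frontier x z
          maximal V V-antichain F⊆V {z} z∈V =
            let z≮x = λ z<x → proj₂ z<x (V-antichain z∈V (F⊆V (x∈Frontier x)) (proj₁ z<x))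
                m , m≤z , m∈F = below-Frontier x z≮x
                m≈z = V-antichain (F⊆V m∈F) z∈V m≤z
            in z≮x , λ w w<z → proj₂ m∈F w (≺-respʳ-≈ (Eq.sym m≈z) w<z)

        -- If `z ≺ x` but not `z ≺ y`, some `m ≼ z` lies in `Frontier y`, as does some `v` above
        -- `x`. Then `m ≺ x ≼ v` forces `m ≈ v`, which is absurd.
        Frontier-dom⇒≤pred : ∀ {x y} → _≤dom_ P (Frontier x) (Frontier y) → _≤pred_ P x y
        Frontier-dom⇒≤pred {x} {y} dom z z<x = by-contradiction λ z≮y →
          let v , v∈F , x≤v = dom (x∈Frontier x)
              m , m≤z , m∈F = below-Frontier y z≮y
              m<x = ≼-≺-trans m≤z z<x
              m≈v = Frontier-antichain y m∈F v∈F (≼-trans (proj₁ m<x) x≤v)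
          in ≼⇒⊁ (≼-trans x≤v (reflexive (Eq.sym m≈v))) m<x

        AM⇒pred : BqoSeq (predPreorder P)
        AM⇒pred F lcF =
          let X , good = bqo (λ X → Frontier (F X) , Frontier-maximal (F X)) λ X →
                let n , const = lcF X in n , λ Y X≈Y → cong (λ x → Frontier x , Frontier-maximal x) (const Y X≈Y)
          in X , Frontier-dom⇒≤pred good

-- The equivalences, assembled from the implications.

theorem1p7 : (∀ ℓ → ExcludedMiddle ℓ) →
    ∀ {c ℓ₁ ℓ₂} (P : Poset c ℓ₁ ℓ₂) → NoInfiniteAntichain P →
    (Bqo (Poset.preorder P) ⇔ Bqo (succPreorder P)) ×
    (Bqo (Poset.preorder P) ⇔ Bqo (predPreorder P)) ×
    (Bqo (Poset.preorder P) ⇔ Bqo (critPreorder P)) ×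
    (Bqo (Poset.preorder P) ⇔ Bqo (Poset.preorder (AM P)))
theorem1p7 em P no-infinite-antichain =
    mk⇔ P⇒succ-bqo (BqoSeq⇒Bqo P≤ ∘ succ⇒P no-infinite-antichain ∘ Bqo⇒BqoSeq P-succ)
  , mk⇔ P⇒pred-bqo pred⇒P
  , mk⇔ P⇒crit-bqo crit⇒P
  , mk⇔ (BqoSeq⇒Bqo AM≤ ∘ P⇒AM ∘ Bqo⇒BqoSeq P≤)
        (λ bqo → pred⇒P (BqoSeq⇒Bqo P-pred (AM⇒pred no-infinite-antichain (Bqo⇒BqoSeq AM≤ bqo))))
  where
  open Classical em
  open Order P

  P≤     = Poset.preorder P
  AM≤    = Poset.preorder (AM P)
  P-pred = predPreorder P
  P-succ = succPreorder P
  P-crit = critPreorder P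

  P⇒succ-bqo : Bqo P≤ → Bqo P-succ
  P⇒succ-bqo bqo α B o f = let s , t , s◁t , good = bqo α B o f in s , t , s◁t , ≼⇒≤succ good

  P⇒pred-bqo : Bqo P≤ → Bqo P-pred
  P⇒pred-bqo bqo α B o f = let s , t , s◁t , good = bqo α B o f in s , t , s◁t , ≼⇒≤pred good

  P⇒crit-bqo : Bqo P≤ → Bqo P-crit
  P⇒crit-bqo bqo α B o f =
    let s , t , s◁t , good = bqo α B o f in s , t , s◁t , ≼⇒≤pred good , ≼⇒≤succ good

  pred⇒P : Bqo P-pred → Bqo P≤
  pred⇒P = BqoSeq⇒Bqo P≤ ∘ succ⇒P no-infinite-antichain ∘ pred⇒succ ∘ Bqo⇒BqoSeq P-pred

  crit⇒P : Bqo P-crit → Bqo P≤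
  crit⇒P bqo = pred⇒P λ α B o f →
    let s , t , s◁t , good , _ = bqo α B o f in s , t , s◁t , good
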